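{- For every simple digraph $H$ there is a constant $c_H$ (depending only on $H$) such that for every positive integer $k\ge 2$ and every tournament $T$, at least one of the following holds: (i) $T$ contains $k$ pairwise vertex-disjoint topological minor copies of $H$; or (ii) there is a set of at most $c_H\cdot k\log k$ vertices of $T$ that intersects all topological minor copies of $H$ in $T$. In other words, $H$ has the Erdős–Pósa property for topological minors in tournaments with bounding function $f(k)\in\mathcal{O}_H(k\log k)$.
   Context: All digraphs are finite and simple. A tournament is a simple digraph in which every pair of distinct vertices is joined by exactly one arc. A digraph $\widehat H$ is a topological minor copy (model) of a digraph $H$ if there is a mapping $\phi$ sending vertices of $H$ to pairwise distinct vertices of $\widehat H$ and each arc $(u,v)$ of $H$ to a directed path in $\widehat H$ from $\phi(u)$ to $\phi(v)$, such that these paths are internally vertex-disjoint, contain no vertex $\phi(w)$, $w\in V(H)$, as an internal vertex, and every arc of $\widehat H$ and every vertex of $\widehat H$ not of the form $\phi(w)$ lies on the image of exactly one arc of $H$. A digraph $G$ contains $H$ as a topological minor if some subgraph of $G$ is a topological minor copy of $H$. Logarithms are base 2. -}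

module Defs where

open import Data.Nat using (ℕ; zero; suc; _+_; _*_; _≤_)
open import Data.Nat.Logarithm using (⌊log₂_⌋)
open import Data.Fin using (Fin)
open import Data.Bool using (Bool; true; false)
open import Data.List using (List; []; _∷_; length)
open import Data.List.Membership.Propositional using (_∈_)
open import Data.List.Relation.Unary.Unique.Propositional using (Unique)
open import Data.Product using (Σ; ∃; ∃-syntax; _×_; _,_)
open import Data.Sum using (_⊎_)
open import Relation.Binary.PropositionalEquality using (_≡_; _≢_)
open import Relation.Nullary using (¬_)
open import Function.Definitions using (Injective)

-- A finite simple digraph on vertex set Fin size.
-- Arcs are given by a Boolean adjacency function (so no parallel arcs),
-- and there are no loops.  (Opposite arcs u→v and v→u may both exist.)
record Digraph : Set where
  field
    size     : ℕ
    Adj      : Fin size → Fin size → Bool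
    loopless : ∀ v → Adj v v ≡ false
open Digraph public

Arc : (G : Digraph) → Fin (size G) → Fin (size G) → Set
Arc G u v = Adj G u v ≡ true

IsTournament : Digraph → Set
IsTournament T =
  ∀ u v → u ≢ v → (Arc T u v ⊎ Arc T v u) × ¬ (Arc T u v × Arc T v u)

data Walk (G : Digraph) : Fin (size G) → Fin (size G) → List (Fin (size G)) → Set where
  here : ∀ {a} → Walk G a a (a ∷ [])
  step : ∀ {a b c vs} → Arc G a b → Walk G b c vs → Walk G a c (a ∷ vs)

IsPath : (G : Digraph) → Fin (size G) → Fin (size G) → List (Fin (size G)) → Set
IsPath G a b vs = Walk G a b vs × Unique vs

-- A topological minor model (copy) of H inside G: branch vertices φ(w)
-- (pairwise distinct), and for every arc (u,v) of H a directed path in G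
-- from φ u to φ v; the paths are internally vertex-disjoint and no internal
-- vertex of a path is a branch vertex.  The copy is the union of the branch
-- vertices and the paths (hence a subgraph of G; each of its arcs/non-branch
-- vertices lies on exactly one path, as H is simple).
record TopMinorModel (H G : Digraph) : Set where
  field
    φ        : Fin (size H) → Fin (size G)
    φ-inj    : Injective _≡_ _≡_ φ
    path     : (u v : Fin (size H)) → Arc H u v → List (Fin (size G))
    path-ok  : ∀ u v (e : Arc H u v) → IsPath G (φ u) (φ v) (path u v e)

  Internal : Fin (size G) → (u v : Fin (size H)) → Arc H u v → Set
  Internal x u v e = x ∈ path u v e × x ≢ φ u × x ≢ φ v

  field
    internal-not-branch : ∀ x u v e w → Internal x u v e → x ≢ φ w
    internally-disjoint : ∀ x u v e u' v' e' →
      Internal x u v e → Internal x u' v' e' → (u ≡ u') × (v ≡ v')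
open TopMinorModel public

InModel : ∀ {H G} → TopMinorModel H G → Fin (size G) → Set
InModel {H} M x =
  (∃[ w ] φ M w ≡ x) ⊎ (Σ (Fin (size H)) λ u → Σ (Fin (size H)) λ v →
                        Σ (Arc H u v) λ e → x ∈ path M u v e)

PairwiseDisjoint : ∀ {H G} {k : ℕ} → (Fin k → TopMinorModel H G) → Set
PairwiseDisjoint {k = k} M =
  ∀ (i j : Fin k) → i ≢ j → ∀ x → InModel (M i) x → ¬ InModel (M j) x

HittingSet : (H G : Digraph) → List (Fin (size G)) → Set
HittingSet H G S = ∀ (M : TopMinorModel H G) → ∃[ x ] (x ∈ S × InModel M x)

{-# OPTIONS --safe #-}
-- Suppose T has no k disjoint models of H.  Compare outdegrees.  If many
-- vertices had nearly equal outdegree, or if many disjoint arcs led from low to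
-- much higher outdegree, then any two of suitable branch vertices would be joined
-- by so many short paths that k disjoint models could be picked greedily.  Hence
-- deleting O(k) vertices separates the low from the high outdegrees, at any chosen
-- threshold, with all remaining arcs going from high to low.  Choosing the
-- threshold that halves the packing number and recursing on both sides deletes
-- O(k log k) vertices and leaves linearly ordered layers without a model of H,
-- with all arcs between different layers pointing down.
--
-- A remaining model spreads over several layers, so some cut between layers
-- splits it into a model of H[U] above and one of H[W ∖ U] below, U a nonempty
-- proper subset of W = V(H) that no arc enters.  Fix U.  Above the last cut with
-- k disjoint models of H[U] above it, these are few; below it, disjoint models
-- of H[W ∖ U] are few, since k of them would combine with those of H[U].
-- By induction on |W| both kinds are hit by O(k log k) vertices.
module Submission where

open import Defs
open import Axiom.UniquenessOfIdentityProofs using (module Decidable⇒UIP)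
open import Data.Bool using (true; false; if_then_else_)
import Data.Bool.Properties as Bool
open import Data.Fin using (Fin; zero; suc; combine; remQuot)
import Data.Fin as Fin
import Data.Fin.Properties as Fin
open import Data.Fin.Subset
open import Data.Fin.Subset.Properties
open import Data.List using (List; []; _∷_; length; map)
import Data.List.Membership.DecPropositional as DecMembership
open import Data.List.Membership.Propositional using () renaming (_∈_ to _∈ˡ_)
open import Data.List.Membership.Propositional.Properties using (∈-map⁺)
open import Data.List.Properties using (length-map)
open import Data.List.Relation.Unary.All as All using ([]; _∷_)
open import Data.List.Relation.Unary.AllPairs using ([]; _∷_)
open import Data.List.Relation.Unary.Any using (here; there)
open import Data.List.Relation.Unary.Unique.Propositional using (Unique)
open import Data.Nat using (ℕ; zero; suc; _+_; _*_; _∸_; _^_; _≤_; _<_; z≤n; s≤s; s≤s⁻¹; _≤?_; _<?_; ⌊_/2⌋)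
open import Data.Nat.Induction using (<-rec)
open import Data.Nat.Logarithm using (⌊log₂_⌋; ⌊log₂⌋-mono-≤; ⌊log₂⌊n/2⌋⌋≡⌊log₂n⌋∸1)
open import Data.Nat.Properties
open import Data.Nat.Tactic.RingSolver using (solve-∀)
open import Data.Product using (Σ; ∃; ∃-syntax; _×_; _,_; proj₁; proj₂)
open import Data.Product.Properties using (≡-dec)
open import Data.Sum using (_⊎_; inj₁; inj₂; [_,_]′)
import Data.Unit as Unit
open import Data.Vec using (Vec; []; _∷_; tabulate; lookup; here; there)
open import Data.Vec.Properties using (lookup∘tabulate; []=⇒lookup; lookup⇒[]=)
open import Function using (_∘_; id; _$_)
open import Function.Definitions using (Injective)
open import Relation.Binary.Definitions using (tri<; tri≈; tri>)
open import Relation.Binary.PropositionalEquality using (_≡_; _≢_; _≗_; refl; sym; trans; cong; cong₂; subst; subst₂)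
open import Relation.Nullary using (¬_; Dec; yes; no; does; contradiction)
open import Relation.Nullary.Decidable using (dec-true; ¬?; _×-dec_; _→-dec_; _⊎-dec_; decidable-stable; map′)
open import Relation.Unary using (Decidable)

private variable
  ν m : ℕ

-- Finite sets

Disjoint : Subset ν → Subset ν → Set
Disjoint p q = ∀ {x} → x ∈ p → x ∉ q

x∈p─q⇒x∉q : ∀ {x} (p q : Subset ν) → x ∈ p ─ q → x ∉ q
x∈p─q⇒x∉q (_ ∷ p) (outside ∷ q) (there x∈) (there x∈q) = x∈p─q⇒x∉q p q x∈ x∈q
x∈p─q⇒x∉q (_ ∷ p) (inside  ∷ q) (there x∈) (there x∈q) = x∈p─q⇒x∉q p q x∈ x∈q

x∈p-y⇒x≢y : ∀ {x} (p : Subset ν) y → x ∈ p - y → x ≢ y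
x∈p-y⇒x≢y p y x∈ refl = x∈p─q⇒x∉q p ⁅ y ⁆ x∈ (x∈⁅x⁆ y)

─-mono : ∀ {p p′ q q′ : Subset ν} → p ⊆ p′ → q′ ⊆ q → p ─ q ⊆ p′ ─ q′
─-mono {p = p} {q = q} p⊆ q′⊆ x∈ =
  x∈p∧x∉q⇒x∈p─q (p⊆ (p─q⊆p p q x∈)) (x∈p─q⇒x∉q p q x∈ ∘ q′⊆)

∪-least : ∀ {p q r : Subset ν} → p ⊆ r → q ⊆ r → p ∪ q ⊆ r
∪-least {p = p} {q} p⊆r q⊆r x∈ = [ p⊆r , q⊆r ]′ (x∈p∪q⁻ p q x∈)

∣p∪q∣≤∣p∣+∣q∣ : (p q : Subset ν) → ∣ p ∪ q ∣ ≤ ∣ p ∣ + ∣ q ∣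
∣p∪q∣≤∣p∣+∣q∣ [] [] = z≤n
∣p∪q∣≤∣p∣+∣q∣ (outside ∷ p) (outside ∷ q) = ∣p∪q∣≤∣p∣+∣q∣ p q
∣p∪q∣≤∣p∣+∣q∣ (outside ∷ p) (inside ∷ q) =
  ≤-trans (s≤s (∣p∪q∣≤∣p∣+∣q∣ p q)) (≤-reflexive (sym (+-suc ∣ p ∣ ∣ q ∣)))
∣p∪q∣≤∣p∣+∣q∣ (inside ∷ p) (outside ∷ q) = s≤s (∣p∪q∣≤∣p∣+∣q∣ p q)
∣p∪q∣≤∣p∣+∣q∣ (inside ∷ p) (inside ∷ q) =
  s≤s (≤-trans (∣p∪q∣≤∣p∣+∣q∣ p q) (+-monoʳ-≤ ∣ p ∣ (n≤1+n ∣ q ∣)))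

∣p∪q∣≤ : ∀ {a b} (p q : Subset ν) → ∣ p ∣ ≤ a → ∣ q ∣ ≤ b → ∣ p ∪ q ∣ ≤ a + b
∣p∪q∣≤ p q p≤ q≤ = ≤-trans (∣p∪q∣≤∣p∣+∣q∣ p q) (+-mono-≤ p≤ q≤)

∣p─q∣+∣p∩q∣≡∣p∣ : (p q : Subset ν) → ∣ p ─ q ∣ + ∣ p ∩ q ∣ ≡ ∣ p ∣
∣p─q∣+∣p∩q∣≡∣p∣ [] [] = refl
∣p─q∣+∣p∩q∣≡∣p∣ (outside ∷ p) (outside ∷ q) = ∣p─q∣+∣p∩q∣≡∣p∣ p q
∣p─q∣+∣p∩q∣≡∣p∣ (outside ∷ p) (inside ∷ q) = ∣p─q∣+∣p∩q∣≡∣p∣ p q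
∣p─q∣+∣p∩q∣≡∣p∣ (inside ∷ p) (outside ∷ q) = cong suc (∣p─q∣+∣p∩q∣≡∣p∣ p q)
∣p─q∣+∣p∩q∣≡∣p∣ (inside ∷ p) (inside ∷ q) =
  trans (+-suc ∣ p ─ q ∣ ∣ p ∩ q ∣) (cong suc (∣p─q∣+∣p∩q∣≡∣p∣ p q))

∣p∣≤∣q∣+∣p─q∣ : (p q : Subset ν) → ∣ p ∣ ≤ ∣ q ∣ + ∣ p ─ q ∣
∣p∣≤∣q∣+∣p─q∣ p q = begin
  ∣ p ∣                   ≡⟨ ∣p─q∣+∣p∩q∣≡∣p∣ p q ⟨
  ∣ p ─ q ∣ + ∣ p ∩ q ∣   ≤⟨ +-monoʳ-≤ ∣ p ─ q ∣ (∣p∩q∣≤∣q∣ p q) ⟩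
  ∣ p ─ q ∣ + ∣ q ∣       ≡⟨ +-comm ∣ p ─ q ∣ ∣ q ∣ ⟩
  ∣ q ∣ + ∣ p ─ q ∣       ∎
  where open ≤-Reasoning

∣q∣≤∣p∣+d⇒∣q─p∣≤∣p─q∣+d : ∀ {d} (p q : Subset ν) → ∣ q ∣ ≤ ∣ p ∣ + d → ∣ q ─ p ∣ ≤ ∣ p ─ q ∣ + d
∣q∣≤∣p∣+d⇒∣q─p∣≤∣p─q∣+d {d = d} p q q≤ = +-cancelʳ-≤ ∣ p ∩ q ∣ _ _ $ begin
  ∣ q ─ p ∣ + ∣ p ∩ q ∣         ≡⟨ cong (λ r → ∣ q ─ p ∣ + ∣ r ∣) (∩-comm p q) ⟩
  ∣ q ─ p ∣ + ∣ q ∩ p ∣         ≡⟨ ∣p─q∣+∣p∩q∣≡∣p∣ q p ⟩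
  ∣ q ∣                         ≤⟨ q≤ ⟩
  ∣ p ∣ + d                     ≡⟨ cong (_+ d) (∣p─q∣+∣p∩q∣≡∣p∣ p q) ⟨
  ∣ p ─ q ∣ + ∣ p ∩ q ∣ + d     ≡⟨ rearrange ∣ p ─ q ∣ ∣ p ∩ q ∣ d ⟩
  ∣ p ─ q ∣ + d + ∣ p ∩ q ∣     ∎
  where
  open ≤-Reasoning
  rearrange : ∀ a b c → a + b + c ≡ a + c + b
  rearrange = solve-∀

∃∈∉ : (p q : Subset ν) → ∣ q ∣ < ∣ p ∣ → ∃[ x ] (x ∈ p × x ∉ q)
∃∈∉ p q q<p with Fin.any? (λ x → x ∈? p ×-dec ¬? (x ∈? q))
... | yes found = found
... | no none = contradiction (p⊆q⇒∣p∣≤∣q∣ p⊆q) (<⇒≱ q<p)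
  where
  p⊆q : p ⊆ q
  p⊆q {x} x∈p = decidable-stable (x ∈? q) λ x∉q → none (x , x∈p , x∉q)

opaque
  ⟪_⟫ : {P : Fin ν → Set} → Decidable P → Subset ν
  ⟪ P? ⟫ = tabulate (does ∘ P?)

  ∈⟪⟫⁺ : ∀ {P : Fin ν → Set} (P? : Decidable P) {x} → P x → x ∈ ⟪ P? ⟫
  ∈⟪⟫⁺ P? {x} px =
    lookup⇒[]= x ⟪ P? ⟫ (trans (lookup∘tabulate (does ∘ P?) x) (dec-true (P? x) px))

  ∈⟪⟫⁻ : ∀ {P : Fin ν → Set} (P? : Decidable P) {x} → x ∈ ⟪ P? ⟫ → P x
  ∈⟪⟫⁻ P? {x} x∈ with P? x | trans (sym (lookup∘tabulate (does ∘ P?) x)) ([]=⇒lookup x∈)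
  ... | yes px | _ = px

⋃ᶠ : (Fin m → Subset ν) → Subset ν
⋃ᶠ {zero}  f = ⊥
⋃ᶠ {suc m} f = f zero ∪ ⋃ᶠ (f ∘ suc)

∈⋃ᶠ⁺ : (f : Fin m → Subset ν) → ∀ i {x} → x ∈ f i → x ∈ ⋃ᶠ f
∈⋃ᶠ⁺ f zero    x∈ = p⊆p∪q _ x∈
∈⋃ᶠ⁺ f (suc i) x∈ = q⊆p∪q (f zero) _ (∈⋃ᶠ⁺ (f ∘ suc) i x∈)

∈⋃ᶠ⁻ : (f : Fin m → Subset ν) → ∀ {x} → x ∈ ⋃ᶠ f → ∃[ i ] x ∈ f i
∈⋃ᶠ⁻ {zero}  f x∈ = contradiction x∈ ∉⊥
∈⋃ᶠ⁻ {suc m} f x∈ with x∈p∪q⁻ (f zero) _ x∈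
... | inj₁ x∈₀ = zero , x∈₀
... | inj₂ x∈ₛ = let i , x∈ᵢ = ∈⋃ᶠ⁻ (f ∘ suc) x∈ₛ in suc i , x∈ᵢ

∣⋃ᶠ∣≤ : ∀ {s} (f : Fin m → Subset ν) → (∀ i → ∣ f i ∣ ≤ s) → ∣ ⋃ᶠ f ∣ ≤ m * s
∣⋃ᶠ∣≤ {zero} {ν} f f≤ = ≤-reflexive (∣⊥∣≡0 ν)
∣⋃ᶠ∣≤ {suc m} f f≤ = ∣p∪q∣≤ (f zero) _ (f≤ zero) (∣⋃ᶠ∣≤ (f ∘ suc) (f≤ ∘ suc))

∣⁅x⁆∣≤1 : (x : Fin ν) → ∣ ⁅ x ⁆ ∣ ≤ 1
∣⁅x⁆∣≤1 x = ≤-reflexive (∣⁅x⁆∣≡1 x)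

-- The union of the sets chosen for the `2 ^ h` many `U` serves all of them, since `Q` is monotone.
uniform-over-subsets : ∀ h {b} (Q : Subset h → Subset ν → Set) →
  (∀ U {Z Z′} → Z ⊆ Z′ → Q U Z → Q U Z′) →
  (∀ U → ∃[ Z ] (∣ Z ∣ ≤ b × Q U Z)) →
  ∃[ Z ] (∣ Z ∣ ≤ 2 ^ h * b × (∀ U → Q U Z))
uniform-over-subsets zero {b} Q mono choose =
  let Z , Z≤ , QZ = choose [] in Z , ≤-trans Z≤ (≤-reflexive (sym (+-identityʳ b))) , λ { [] → QZ }
uniform-over-subsets (suc h) {b} Q mono choose =
  let Z₁ , Z₁≤ , Q₁ = uniform-over-subsets h (Q ∘ (inside ∷_)) (mono ∘ (inside ∷_)) (choose ∘ (inside ∷_))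
      Z₂ , Z₂≤ , Q₂ = uniform-over-subsets h (Q ∘ (outside ∷_)) (mono ∘ (outside ∷_)) (choose ∘ (outside ∷_))
  in Z₁ ∪ Z₂
   , ≤-trans (∣p∪q∣≤ Z₁ Z₂ Z₁≤ Z₂≤) (≤-reflexive (double (2 ^ h) b))
   , λ { (inside ∷ U) → mono (inside ∷ U) (p⊆p∪q Z₂) (Q₁ U)
       ; (outside ∷ U) → mono (outside ∷ U) (q⊆p∪q Z₁ Z₂) (Q₂ U) }
  where
  double : ∀ a b → a * b + a * b ≡ 2 * a * b
  double = solve-∀

-- Sums over finite sets and averaging

∑ : Subset ν → (Fin ν → ℕ) → ℕ
∑ []            f = 0
∑ (outside ∷ p) f = ∑ p (f ∘ suc)
∑ (inside  ∷ p) f = f zero + ∑ p (f ∘ suc)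

∑-mono : ∀ (p : Subset ν) {f g} → (∀ {x} → x ∈ p → f x ≤ g x) → ∑ p f ≤ ∑ p g
∑-mono []            f≤g = z≤n
∑-mono (outside ∷ p) f≤g = ∑-mono p (f≤g ∘ there)
∑-mono (inside  ∷ p) f≤g = +-mono-≤ (f≤g here) (∑-mono p (f≤g ∘ there))

∑-const : ∀ (p : Subset ν) c → ∑ p (λ _ → c) ≡ ∣ p ∣ * c
∑-const []            c = refl
∑-const (outside ∷ p) c = ∑-const p c
∑-const (inside  ∷ p) c = cong (c +_) (∑-const p c)

∑-+ : ∀ (p : Subset ν) f g → ∑ p (λ x → f x + g x) ≡ ∑ p f + ∑ p g
∑-+ []            f g = refl
∑-+ (outside ∷ p) f g = ∑-+ p (f ∘ suc) (g ∘ suc)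
∑-+ (inside  ∷ p) f g =
  trans (cong (f zero + g zero +_) (∑-+ p (f ∘ suc) (g ∘ suc)))
        (interchange (f zero) (g zero) (∑ p (f ∘ suc)) (∑ p (g ∘ suc)))
  where
  interchange : ∀ a b c d → a + b + (c + d) ≡ a + c + (b + d)
  interchange = solve-∀

∑-swap : ∀ (p : Subset ν) (q : Subset m) (f : Fin ν → Fin m → ℕ) →
  ∑ p (λ x → ∑ q (f x)) ≡ ∑ q (λ y → ∑ p (λ x → f x y))
∑-swap [] q f = sym (trans (∑-const q 0) (*-zeroʳ ∣ q ∣))
∑-swap (outside ∷ p) q f = ∑-swap p q (f ∘ suc)
∑-swap (inside  ∷ p) q f =
  trans (cong (∑ q (f zero) +_) (∑-swap p q (f ∘ suc)))
        (sym (∑-+ q (f zero) (λ y → ∑ p (λ x → f (suc x) y))))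

opaque
  unfolding ⟪_⟫

  ∣p∩⟪⟫∣≡∑ : ∀ {P : Fin ν → Set} (p : Subset ν) (P? : Decidable P) →
    ∣ p ∩ ⟪ P? ⟫ ∣ ≡ ∑ p (λ x → if does (P? x) then 1 else 0)
  ∣p∩⟪⟫∣≡∑ [] P? = refl
  ∣p∩⟪⟫∣≡∑ (outside ∷ p) P? = ∣p∩⟪⟫∣≡∑ p (P? ∘ suc)
  ∣p∩⟪⟫∣≡∑ (inside ∷ p) P? with does (P? zero)
  ... | true  = cong suc (∣p∩⟪⟫∣≡∑ p (P? ∘ suc))
  ... | false = ∣p∩⟪⟫∣≡∑ p (P? ∘ suc)

-- Double counting: each ordered pair or its reverse is counted by some row.
total⇒∣p∣≤2*row : ∀ {R : Fin ν → Fin ν → Set} (R? : ∀ x → Decidable (R x)) →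
  (∀ x y → R x y ⊎ R y x) → ∀ E (p : Subset ν) →
  (∀ {x} → x ∈ p → ∣ p ∩ ⟪ R? x ⟫ ∣ ≤ E) → ∣ p ∣ ≤ 2 * E
total⇒∣p∣≤2*row {ν} {R} R? total E p row≤ = cancel ∣ p ∣ refl
  where
  open ≤-Reasoning
  r : Fin ν → Fin ν → ℕ
  r x y = if does (R? x y) then 1 else 0

  1≤r+r : ∀ x y → 1 ≤ r x y + r y x
  1≤r+r x y with R? x y | R? y x
  ... | yes _ | _     = s≤s z≤n
  ... | no  _ | yes _ = s≤s z≤n
  ... | no ¬xy | no ¬yx = contradiction (total x y) [ ¬xy , ¬yx ]′

  -- `S` counts the related pairs in `p`. Together with the reversed pairs it accounts for all
  -- `∣ p ∣ * ∣ p ∣` pairs, hence the factor 2.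
  S = ∑ p (λ x → ∑ p (r x))

  S≤ : S ≤ ∣ p ∣ * E
  S≤ = begin
    S                   ≤⟨ ∑-mono p (λ {x} x∈ → subst (_≤ E) (∣p∩⟪⟫∣≡∑ p (R? x)) (row≤ x∈)) ⟩
    ∑ p (λ _ → E)       ≡⟨ ∑-const p E ⟩
    ∣ p ∣ * E           ∎

  square≤ : ∣ p ∣ * ∣ p ∣ ≤ ∣ p ∣ * (2 * E)
  square≤ = begin
    ∣ p ∣ * ∣ p ∣                                  ≡⟨ cong (∣ p ∣ *_) (*-identityʳ ∣ p ∣) ⟨
    ∣ p ∣ * (∣ p ∣ * 1)                            ≡⟨ cong (∣ p ∣ *_) (∑-const p 1) ⟨
    ∣ p ∣ * ∑ p (λ _ → 1)                          ≡⟨ ∑-const p _ ⟨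
    ∑ p (λ _ → ∑ p (λ _ → 1))                      ≤⟨ ∑-mono p (λ {x} _ → ∑-mono p (λ {y} _ → 1≤r+r x y)) ⟩
    ∑ p (λ x → ∑ p (λ y → r x y + r y x))          ≤⟨ ∑-mono p (λ {x} _ → ≤-reflexive (∑-+ p (r x) (λ y → r y x))) ⟩
    ∑ p (λ x → ∑ p (r x) + ∑ p (λ y → r y x))      ≡⟨ ∑-+ p (λ x → ∑ p (r x)) (λ x → ∑ p (λ y → r y x)) ⟩
    S + ∑ p (λ x → ∑ p (λ y → r y x))              ≡⟨ cong (S +_) (∑-swap p p r) ⟨
    S + S                                          ≤⟨ +-mono-≤ S≤ S≤ ⟩
    ∣ p ∣ * E + ∣ p ∣ * E                          ≡⟨ double ∣ p ∣ E ⟩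
    ∣ p ∣ * (2 * E)                                ∎
    where
    double : ∀ a b → a * b + a * b ≡ a * (2 * b)
    double = solve-∀

  cancel : ∀ s → ∣ p ∣ ≡ s → ∣ p ∣ ≤ 2 * E
  cancel zero    eq = subst (_≤ 2 * E) (sym eq) z≤n
  cancel (suc s) eq rewrite eq = *-cancelˡ-≤ (suc s) (subst (λ t → t * t ≤ t * (2 * E)) eq square≤)

-- Greedy choice

-- `foot a` is what a choice blocks for later ones. Each blocks at most `s` vertices, so the
-- forbidden set stays within `N` for `m` rounds. A foot may be larger than the chosen object, so
-- avoidance is promised only from earlier to later choices.
greedy : ∀ m (A : Fin m → Set) (foot : ∀ {i} → A i → Subset ν) (Avoid : ∀ {i} → A i → Subset ν → Set) →
  (∀ {i} (a : A i) {F G} → F ⊆ G → Avoid a G → Avoid a F) → ∀ {s N} →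
  (∀ i F → ∣ F ∣ ≤ N → Σ (A i) λ a → ∣ foot a ∣ ≤ s × Avoid a F) →
  ∀ F → ∣ F ∣ + m * s ≤ N →
  Σ (∀ i → A i) λ a → (∀ i → Avoid (a i) F) × (∀ {i j} → i Fin.< j → Avoid (a j) (foot (a i)))
greedy zero A foot Avoid anti pick F F≤ = (λ ()) , (λ ()) , λ { {()} }
greedy (suc m) A foot Avoid anti {s} {N} pick F F≤ =
  let a₀ , a₀≤ , a₀-avoids = pick zero F (≤-trans (m≤m+n ∣ F ∣ _) F≤)
      F′≤ = begin
        ∣ F ∪ foot a₀ ∣ + m * s   ≤⟨ +-monoˡ-≤ (m * s) (∣p∪q∣≤ F (foot a₀) ≤-refl a₀≤) ⟩
        ∣ F ∣ + s + m * s         ≡⟨ +-assoc ∣ F ∣ s (m * s) ⟩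
        ∣ F ∣ + (s + m * s)       ≤⟨ F≤ ⟩
        N                         ∎
      a , avoids , later = greedy m (A ∘ suc) foot Avoid anti (pick ∘ suc) (F ∪ foot a₀) F′≤
  in (λ { zero → a₀ ; (suc i) → a i })
   , (λ { zero → a₀-avoids ; (suc i) → anti (a i) (p⊆p∪q (foot a₀)) (avoids i) })
   , λ { {zero} {suc j} _ → anti (a j) (q⊆p∪q F (foot a₀)) (avoids j)
       ; {suc i} {suc j} (s≤s i<j) → later i<j }
  where open ≤-Reasoning

pick-distinct : ∀ m (p F : Subset ν) → ∣ F ∣ + m < ∣ p ∣ →
  Σ (Fin m → Fin ν) λ f → (∀ i → f i ∈ p) × (∀ i → f i ∉ F) × Injective _≡_ _≡_ f
pick-distinct {ν} m p F F< = f , (λ i → proj₂ (a i)) , avoids , injective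
  where
  choice = greedy m (λ _ → Σ (Fin ν) (_∈ p)) (λ (x , _) → ⁅ x ⁆) (λ (x , _) F → x ∉ F)
    (λ _ F⊆G x∉G → x∉G ∘ F⊆G) {1} {∣ F ∣ + m}
    (λ _ G G≤ → let x , x∈ , x∉ = ∃∈∉ p G (≤-<-trans G≤ F<) in (x , x∈) , ∣⁅x⁆∣≤1 x , x∉)
    F (≤-reflexive (cong (∣ F ∣ +_) (*-identityʳ m)))
  a = proj₁ choice
  avoids = proj₁ (proj₂ choice)
  later = proj₂ (proj₂ choice)
  f = proj₁ ∘ a

  injective : Injective _≡_ _≡_ f
  injective {i} {j} eq with Fin.<-cmp i j
  ... | tri< i<j _ _ = contradiction (subst (_∈ ⁅ f i ⁆) eq (x∈⁅x⁆ (f i))) (later i<j)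
  ... | tri≈ _ i≡j _ = i≡j
  ... | tri> _ _ j<i = contradiction (subst (_∈ ⁅ f j ⁆) (sym eq) (x∈⁅x⁆ (f j))) (later j<i)

-- Discrete intermediate value: descend from `m` until `P` first fails. This locates degree
-- thresholds as well as cuts between layers.
step-up : ∀ {P : ℕ → Set} → (∀ a → Dec (P a)) → ∀ m → P m → P 0 ⊎ ∃[ a ] (¬ P a × P (suc a))
step-up P? zero    p = inj₁ p
step-up P? (suc m) p with P? m
... | yes pm = step-up P? m pm
... | no ¬pm = inj₂ (m , ¬pm , p)

-- Exhaustive search

Searchable : Set → Set₁
Searchable A = ∀ {P : A → Set} → Decidable P → Dec (∃ P)

search-× : ∀ {A B} → Searchable A → Searchable B → Searchable (A × B)
search-× sA sB P? =
  map′ (λ (a , b , p) → (a , b) , p) (λ ((a , b) , p) → a , b , p) (sA λ a → sB λ b → P? (a , b))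

search-Vec : ∀ {A} → Searchable A → ∀ m → Searchable (Vec A m)
search-Vec sA zero    P? = map′ ([] ,_) (λ { ([] , p) → p }) (P? [])
search-Vec sA (suc m) P? =
  map′ (λ (a , as , p) → a ∷ as , p) (λ { (a ∷ as , p) → a , as , p })
       (sA λ a → search-Vec sA m λ as → P? (a ∷ as))

-- Constants and the recursion behind k log k

-- Per unit of k: a bound on the vertices of middle outdegree, and one on a cover
-- of the arcs from low to high outdegree.
sepConst : ℕ → ℕ
sepConst h = let s = h * (h * 3) in
  s + h * (2 * (4 * s) + 2 * (1 + 4 * s)) + (s + h * (3 + 2 * h) * 2)

-- The summand 1 makes `bound-halve` hold also at `k = 1`, where the logarithm vanishes.
bound : ℕ → ℕ
bound k = k * (1 + ⌊log₂ k ⌋)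

-- The second argument bounds `∣ W ∣`. The first summand pays for the layering, the second for
-- hitting both pieces of a split, over all `2 ^ h` subsets `U`.
hitConst : ℕ → ℕ → ℕ
hitConst h zero    = 0
hitConst h (suc j) = sepConst h * 2 + 2 ^ h * (hitConst h j + hitConst h j)

⌊n/2⌋+⌊n/2⌋≤n : ∀ n → ⌊ n /2⌋ + ⌊ n /2⌋ ≤ n
⌊n/2⌋+⌊n/2⌋≤n n =
  ≤-trans (+-monoʳ-≤ ⌊ n /2⌋ (⌊n/2⌋≤⌈n/2⌉ n)) (≤-reflexive (⌊n/2⌋+⌈n/2⌉≡n n))

n≤1+⌊n/2⌋+⌊n/2⌋ : ∀ n → n ≤ suc (⌊ n /2⌋ + ⌊ n /2⌋)
n≤1+⌊n/2⌋+⌊n/2⌋ zero = z≤n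
n≤1+⌊n/2⌋+⌊n/2⌋ (suc zero) = s≤s z≤n
n≤1+⌊n/2⌋+⌊n/2⌋ (suc (suc n)) =
  s≤s (≤-trans (s≤s (n≤1+⌊n/2⌋+⌊n/2⌋ n)) (≤-reflexive (cong suc (sym (+-suc ⌊ n /2⌋ ⌊ n /2⌋)))))

-- Halving `k` lowers the logarithm by one, and the saving pays for the summand `k`.
bound-halve : ∀ k → k + (bound ⌊ k /2⌋ + bound ⌊ k /2⌋) ≤ bound k
bound-halve zero = z≤n
bound-halve (suc zero) = s≤s z≤n
bound-halve k@(suc (suc k′)) = begin
  k + (bound ⌊ k /2⌋ + bound ⌊ k /2⌋)                      ≡⟨ cong (λ l → k + (⌊ k /2⌋ * (1 + l) + ⌊ k /2⌋ * (1 + l))) (⌊log₂⌊n/2⌋⌋≡⌊log₂n⌋∸1 k) ⟩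
  k + (⌊ k /2⌋ * (1 + (lg ∸ 1)) + ⌊ k /2⌋ * (1 + (lg ∸ 1)))  ≡⟨ cong (λ l → k + (⌊ k /2⌋ * l + ⌊ k /2⌋ * l)) (m+[n∸m]≡n 1≤lg) ⟩
  k + (⌊ k /2⌋ * lg + ⌊ k /2⌋ * lg)                        ≡⟨ cong (k +_) (*-distribʳ-+ lg ⌊ k /2⌋ ⌊ k /2⌋) ⟨
  k + (⌊ k /2⌋ + ⌊ k /2⌋) * lg                             ≤⟨ +-monoʳ-≤ k (*-monoˡ-≤ lg (⌊n/2⌋+⌊n/2⌋≤n k)) ⟩
  k + k * lg                                               ≡⟨ *-suc k lg ⟨
  bound k                                                  ∎
  where
  open ≤-Reasoning
  lg = ⌊log₂ k ⌋
  1≤lg : 1 ≤ lg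
  1≤lg = ⌊log₂⌋-mono-≤ {2} {k} (s≤s (s≤s z≤n))

-- Reachability, labelled models and their packings

module Models (H T : Digraph) where

  h = size H
  n = size T

  private variable
    a b c : Fin n
    W U V : Subset h
    S S′ A B L R : Subset n

  arcH? : ∀ u v → Dec (Arc H u v)
  arcH? u v = Adj H u v Bool.≟ true

  arc? : ∀ x y → Dec (Arc T x y)
  arc? x y = Adj T x y Bool.≟ true

  -- A walk with at least one arc. `Q` restricts only the vertices visited between its two ends, and
  -- repetitions are allowed.
  data Reach (Q : Fin n → Set) (b : Fin n) : Fin n → Set where
    last : Arc T a b → Reach Q b a
    via  : Arc T a c → Q c → Reach Q b c → Reach Q b a

  Reach-map : ∀ {Q Q′ : Fin n → Set} → (∀ {x} → Q x → Q′ x) → Reach Q b a → Reach Q′ b a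
  Reach-map f (last e)    = last e
  Reach-map f (via e q r) = via e (f q) (Reach-map f r)

  -- Cut at the last visit to `c`: either the walk never passes through `c`, or its final stretch
  -- leaves `c` for good.
  restart : ∀ {P} c → Reach (_∈ P) b a → Reach (_∈ P - c) b a ⊎ Reach (_∈ P - c) b c
  restart c (last e) = inj₁ (last e)
  restart c (via {c = d} e d∈ r) with restart c r | d Fin.≟ c
  ... | inj₂ r′ | _        = inj₂ r′
  ... | inj₁ r′ | yes refl = inj₂ r′
  ... | inj₁ r′ | no d≢c   = inj₁ (via e (x∈p∧x≢y⇒x∈p-y d∈ d≢c) r′)

  restart-here : ∀ {P} → Reach (_∈ P) b a → Reach (_∈ P - a) b a
  restart-here {a = a} r = [ id , id ]′ (restart a r)

  -- By `restart-here` a walk need not return to its first inner vertex `c`, so the search goes on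
  -- in the smaller set `P - c`.
  reach∈? : ∀ m P → ∣ P ∣ ≤ m → ∀ b a → Dec (Reach (_∈ P) b a)
  reach∈? m P P≤ b a with arc? a b
  ... | yes e = yes (last e)
  reach∈? zero P P≤ b a | no ¬e =
    no λ { (last e) → ¬e e
         ; (via _ c∈ _) → contradiction (≤-trans (x∈p⇒∣p-x∣<∣p∣ c∈) P≤) λ () }
  reach∈? (suc m) P P≤ b a | no ¬e =
    map′ to from (Fin.any? step?)
    where
    Step : Fin n → Set
    Step c = Arc T a c × Σ (c ∈ P) λ _ → Reach (_∈ P - c) b c

    step? : Decidable Step
    step? c with c ∈? P
    ... | no c∉ = no λ (_ , c∈ , _) → c∉ c∈
    ... | yes c∈ =
      map′ (λ (e , r) → e , c∈ , r) (λ (e , _ , r) → e , r)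
           (arc? a c ×-dec reach∈? m (P - c) (s≤s⁻¹ (≤-trans (x∈p⇒∣p-x∣<∣p∣ c∈) P≤)) b c)

    to : ∃ Step → Reach (_∈ P) b a
    to (c , e , c∈ , r) = via e c∈ (Reach-map (p─q⊆p P ⁅ c ⁆) r)

    from : Reach (_∈ P) b a → ∃ Step
    from (last e)     = contradiction e ¬e
    from (via e c∈ r) = _ , e , c∈ , restart-here r

  reach? : ∀ {Q : Fin n → Set} → Decidable Q → ∀ b a → Dec (Reach Q b a)
  reach? Q? b a =
    map′ (Reach-map (∈⟪⟫⁻ Q?)) (Reach-map (∈⟪⟫⁺ Q?)) (reach∈? n ⟪ Q? ⟫ (∣p∣≤n ⟪ Q? ⟫) b a)

  -- Models of the subgraph of H induced by W inside S

  Label : Set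
  Label = Fin h × Fin h

  _≟ˡ_ : (k l : Label) → Dec (k ≡ l)
  _≟ˡ_ = ≡-dec Fin._≟_ Fin._≟_

  -- A vertex labelled (u , u) is reserved for the branch vertex of u, and one
  -- labelled (u , v) with u ≢ v for the path of the arc (u , v); disjointness of
  -- the paths is thereby automatic.
  record IsModel (φ : Fin h → Fin n) (ℓ : Fin n → Label) (W : Subset h) (S : Subset n) : Set where
    constructor isModel
    field
      branch : ∀ u → u ∈ W → φ u ∈ S × ℓ (φ u) ≡ (u , u)
      conn   : ∀ u v → u ∈ W → v ∈ W → Arc H u v →
               Reach (λ x → x ∈ S × ℓ x ≡ (u , v)) (φ v) (φ u)
  open IsModel

  Model : Subset h → Subset n → Set
  Model W S = ∃[ φ ] ∃[ ℓ ] IsModel φ ℓ W S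

  isModel? : ∀ φ ℓ W S → Dec (IsModel φ ℓ W S)
  isModel? φ ℓ W S =
    map′ (λ (b , c) → isModel b c) (λ M → branch M , conn M)
      (Fin.all? (λ u → u ∈? W →-dec (φ u ∈? S ×-dec ℓ (φ u) ≟ˡ (u , u)))
       ×-dec Fin.all? (λ u → Fin.all? λ v → u ∈? W →-dec (v ∈? W →-dec (arcH? u v →-dec
         reach? (λ x → x ∈? S ×-dec ℓ x ≟ˡ (u , v)) (φ v) (φ u)))))

  isModel-cong : ∀ {φ φ′ ℓ ℓ′} → φ ≗ φ′ → ℓ ≗ ℓ′ → IsModel φ ℓ W S → IsModel φ′ ℓ′ W S
  isModel-cong {φ = φ} {φ′} {ℓ} {ℓ′} φ≗ ℓ≗ M = isModel
    (λ u u∈ → let φ∈ , ℓφ = branch M u u∈ in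
      subst (_∈ _) (φ≗ u) φ∈ , trans (sym (ℓ≗ (φ′ u))) (trans (cong ℓ (sym (φ≗ u))) ℓφ))
    (λ u v u∈ v∈ e → subst₂ (Reach _) (φ≗ v) (φ≗ u)
      (Reach-map (λ {x} (x∈ , ℓx) → x∈ , trans (sym (ℓ≗ x)) ℓx) (conn M u v u∈ v∈ e)))

  opaque
    model? : ∀ W S → Dec (Model W S)
    model? W S = map′
      (λ ((φ , ℓ) , M) → lookup φ , lookup ℓ , M)
      (λ (φ , ℓ , M) → (tabulate φ , tabulate ℓ) ,
        isModel-cong (sym ∘ lookup∘tabulate φ) (sym ∘ lookup∘tabulate ℓ) M)
      (search-× (search-Vec Fin.any? h) (search-Vec (search-× Fin.any? Fin.any?) n)
        λ (φ , ℓ) → isModel? (lookup φ) (lookup ℓ) W S)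

  Model-mono : S ⊆ S′ → Model W S → Model W S′
  Model-mono S⊆ (φ , ℓ , M) = φ , ℓ , isModel
    (λ u u∈ → let φ∈ , ℓφ = branch M u u∈ in S⊆ φ∈ , ℓφ)
    (λ u v u∈ v∈ e → Reach-map (λ (x∈ , ℓx) → S⊆ x∈ , ℓx) (conn M u v u∈ v∈ e))

  Model-restrict : U ⊆ W → Model W S → Model U S
  Model-restrict U⊆ (φ , ℓ , M) =
    φ , ℓ , isModel (λ u → branch M u ∘ U⊆) (λ u v u∈ v∈ → conn M u v (U⊆ u∈) (U⊆ v∈))

  ¬Model-⊥ : Nonempty W → ¬ Model W ⊥
  ¬Model-⊥ (u , u∈) (φ , ℓ , M) = ∉⊥ (proj₁ (branch M u u∈))

  Model-∅ : Fin h → Fin n → Empty W → Model W S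
  Model-∅ u₀ v₀ empty = (λ _ → v₀) , (λ _ → u₀ , u₀) , isModel
    (λ u u∈ → contradiction (u , u∈) empty) (λ u _ u∈ → contradiction (u , u∈) empty)

  -- Turns disjoint reserved sets into a labelling: a vertex is labelled by the pair that owns it.
  assemble : Fin h → (I : Fin h → Fin h → Fin n → Set) → (∀ u v → Decidable (I u v)) →
    (∀ {u v u′ v′ x} → I u v x → I u′ v′ x → (u , v) ≡ (u′ , v′)) →
    (∀ {u v x} → I u v x → x ∈ S) →
    (φ : Fin h → Fin n) → (∀ u → I u u (φ u)) →
    (∀ {u v} → Arc H u v → Reach (I u v) (φ v) (φ u)) → Model W S
  assemble u₀ I I? disj I⊆S φ Iφ walk = φ , ℓ , isModel
    (λ u _ → I⊆S (Iφ u) , ℓ-ok (Iφ u))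
    (λ u v _ _ e → Reach-map (λ i → I⊆S i , ℓ-ok i) (walk e))
    where
    owner? : ∀ x → Dec (∃[ l ] I (proj₁ l) (proj₂ l) x)
    owner? x = search-× Fin.any? Fin.any? λ (u , v) → I? u v x

    ℓ : Fin n → Label
    ℓ x with owner? x
    ... | yes (l , _) = l
    -- A vertex without an owner may get any label, as no branch vertex and no given walk uses it.
    ... | no  _       = u₀ , u₀

    ℓ-ok : ∀ {u v x} → I u v x → ℓ x ≡ (u , v)
    ℓ-ok {x = x} i with owner? x
    ... | yes (_ , j) = disj j i
    ... | no  none    = contradiction (_ , i) none

  Closed : Subset h → Subset h → Set
  Closed U V = ∀ {u v} → u ∈ V → v ∈ U → ¬ Arc H u v

  -- `U` consists of the vertices whose branch vertex lies in `R`. As no arc leads from `L` to `R`,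
  -- walks starting in `L` stay there, walks between vertices of `R` never leave it, and no arc of
  -- `H` can enter `U`.
  split : (∀ {x} → x ∈ S → x ∈ L ⊎ x ∈ R) → (∀ {x y} → x ∈ L → y ∈ R → ¬ Arc T x y) →
    Model W S → ∃[ U ] (U ⊆ W × Closed U (W ─ U) × Model U R × Model (W ─ U) L)
  split {S} {L} {R} {W} S⊆ no-arc (φ , ℓ , M) =
    Uᴿ , Uᴿ⊆W , closed
    , (φ , ℓ , isModel (λ u u∈ → φ∈R u∈ , proj₂ (branch M u (Uᴿ⊆W u∈)))
        (λ u v u∈ v∈ e → stay-R (φ∈R v∈) (conn M u v (Uᴿ⊆W u∈) (Uᴿ⊆W v∈) e)))
    , (φ , ℓ , isModel (λ u u∈ → φ∈L u∈ , proj₂ (branch M u (─⊆ u∈)))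
        (λ u v u∈ v∈ e → stay-L (φ∈L u∈) (conn M u v (─⊆ u∈) (─⊆ v∈) e)))
    where
    inR? : Decidable (λ u → φ u ∈ R)
    inR? u = φ u ∈? R
    Uᴿ = W ∩ ⟪ inR? ⟫
    Uᴿ⊆W : Uᴿ ⊆ W
    Uᴿ⊆W = p∩q⊆p W _
    ─⊆ : W ─ Uᴿ ⊆ W
    ─⊆ = p─q⊆p W Uᴿ

    φ∈R : ∀ {u} → u ∈ Uᴿ → φ u ∈ R
    φ∈R u∈ = ∈⟪⟫⁻ inR? (p∩q⊆q W _ u∈)

    φ∈L : ∀ {u} → u ∈ W ─ Uᴿ → φ u ∈ L
    φ∈L {u} u∈ with S⊆ (proj₁ (branch M u (─⊆ u∈)))
    ... | inj₁ φ∈ = φ∈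
    ... | inj₂ φ∈ = contradiction (x∈p∩q⁺ (─⊆ u∈ , ∈⟪⟫⁺ inR? φ∈)) (x∈p─q⇒x∉q W Uᴿ u∈)

    Q : Label → Subset n → Fin n → Set
    Q l X x = x ∈ X × ℓ x ≡ l

    stay-L : ∀ {l} → a ∈ L → Reach (Q l S) b a → Reach (Q l L) b a
    stay-L a∈ (last e) = last e
    stay-L a∈ (via e (c∈ , ℓc) r) with S⊆ c∈
    ... | inj₁ c∈L = via e (c∈L , ℓc) (stay-L c∈L r)
    ... | inj₂ c∈R = contradiction e (no-arc a∈ c∈R)

    no-cross : ∀ {l} → a ∈ L → b ∈ R → ¬ Reach (Q l S) b a
    no-cross a∈ b∈ (last e) = no-arc a∈ b∈ e
    no-cross a∈ b∈ (via e (c∈ , ℓc) r) with S⊆ c∈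
    ... | inj₁ c∈L = no-cross c∈L b∈ r
    ... | inj₂ c∈R = no-arc a∈ c∈R e

    stay-R : ∀ {l} → b ∈ R → Reach (Q l S) b a → Reach (Q l R) b a
    stay-R b∈ (last e) = last e
    stay-R b∈ (via e (c∈ , ℓc) r) with S⊆ c∈
    ... | inj₁ c∈L = contradiction r (no-cross c∈L b∈)
    ... | inj₂ c∈R = via e (c∈R , ℓc) (stay-R b∈ r)

    closed : Closed Uᴿ (W ─ Uᴿ)
    closed u∈ v∈ e = no-cross (φ∈L u∈) (φ∈R v∈) (conn M _ _ (─⊆ u∈) (Uᴿ⊆W v∈) e)

  -- Arcs of `H` leaving `U` become single arcs of `T` from `A` to `B`; closedness excludes arcs
  -- entering `U`.
  join : W ⊆ U ∪ V → Closed U V → Disjoint A B → (∀ {x y} → x ∈ A → y ∈ B → Arc T x y) →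
    Model U A → Model V B → Model W (A ∪ B)
  join {W} {U} {V} {A} {B} W⊆ closed A∩B A→B (φ₁ , ℓ₁ , M₁) (φ₂ , ℓ₂ , M₂) =
    ψ , ℓ , isModel branch′ conn′
    where
    ψ : Fin h → Fin n
    ψ u = if does (u ∈? U) then φ₁ u else φ₂ u

    ℓ : Fin n → Label
    ℓ x = if does (x ∈? A) then ℓ₁ x else ℓ₂ x

    ℓ-A : ∀ {x l} → x ∈ A → ℓ₁ x ≡ l → ℓ x ≡ l
    ℓ-A {x} x∈ eq with x ∈? A
    ... | yes _ = eq
    ... | no x∉ = contradiction x∈ x∉

    ℓ-B : ∀ {x l} → x ∈ B → ℓ₂ x ≡ l → ℓ x ≡ l
    ℓ-B {x} x∈ eq with x ∈? A
    ... | yes x∈A = contradiction x∈ (A∩B x∈A)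
    ... | no  _   = eq

    ∈V : ∀ {u} → u ∈ W → u ∉ U → u ∈ V
    ∈V u∈ u∉ with x∈p∪q⁻ U V (W⊆ u∈)
    ... | inj₁ u∈U = contradiction u∈U u∉
    ... | inj₂ u∈V = u∈V

    branch′ : ∀ u → u ∈ W → ψ u ∈ A ∪ B × ℓ (ψ u) ≡ (u , u)
    branch′ u u∈ with u ∈? U
    ... | yes u∈U = let φ∈ , eq = branch M₁ u u∈U in p⊆p∪q B φ∈ , ℓ-A φ∈ eq
    ... | no  u∉U = let φ∈ , eq = branch M₂ u (∈V u∈ u∉U) in q⊆p∪q A B φ∈ , ℓ-B φ∈ eq

    conn′ : ∀ u v → u ∈ W → v ∈ W → Arc H u v →
            Reach (λ x → x ∈ A ∪ B × ℓ x ≡ (u , v)) (ψ v) (ψ u)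
    conn′ u v u∈ v∈ e with u ∈? U | v ∈? U
    ... | yes u∈U | yes v∈U =
      Reach-map (λ (x∈ , eq) → p⊆p∪q B x∈ , ℓ-A x∈ eq) (conn M₁ u v u∈U v∈U e)
    ... | yes u∈U | no  v∉U =
      last (A→B (proj₁ (branch M₁ u u∈U)) (proj₁ (branch M₂ v (∈V v∈ v∉U))))
    ... | no  u∉U | yes v∈U = contradiction e (closed (∈V u∈ u∉U) v∈U)
    ... | no  u∉U | no  v∉U =
      Reach-map (λ (x∈ , eq) → q⊆p∪q A B x∈ , ℓ-B x∈ eq) (conn M₂ u v (∈V u∈ u∉U) (∈V v∈ v∉U) e)

  -- Packings

  -- Models are peeled off one at a time with their vertex sets, so disjointness is built in and a
  -- search over subsets decides the property.
  Pack : ℕ → Subset h → Subset n → Set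
  Pack zero    W S = Unit.⊤
  Pack (suc k) W S = ∃[ A ] (A ⊆ S × Model W A × Pack k W (S ─ A))

  opaque
    pack? : ∀ k W S → Dec (Pack k W S)
    pack? zero    W S = yes Unit.tt
    pack? (suc k) W S = anySubset? λ A → A ⊆? S ×-dec (model? W A ×-dec pack? k W (S ─ A))

  Pack-mono : ∀ k → S ⊆ S′ → Pack k W S → Pack k W S′
  Pack-mono zero    S⊆ _ = Unit.tt
  Pack-mono (suc k) S⊆ (A , A⊆ , M , P) =
    A , ⊆-trans A⊆ S⊆ , M , Pack-mono k (─-mono S⊆ ⊆-refl) P

  Pack-≤ : ∀ {k k′} → k ≤ k′ → Pack k′ W S → Pack k W S
  Pack-≤ z≤n       _                = Unit.tt
  Pack-≤ (s≤s k≤) (A , A⊆ , M , P) = A , A⊆ , M , Pack-≤ k≤ P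

  Pack-+ : ∀ i j → L ⊆ S → R ⊆ S → Disjoint L R → Pack i W L → Pack j W R → Pack (i + j) W S
  Pack-+ zero    j L⊆ R⊆ disj _ Q = Pack-mono j R⊆ Q
  Pack-+ (suc i) j L⊆ R⊆ disj (A , A⊆ , M , P) Q =
    A , ⊆-trans A⊆ L⊆ , M ,
    Pack-+ i j (─-mono L⊆ ⊆-refl)
      (λ x∈ → x∈p∧x∉q⇒x∈p─q (R⊆ x∈) (λ x∈A → disj (A⊆ x∈A) x∈))
      (disj ∘ p─q⊆p _ A) P Q

  Pack-join : ∀ k → W ⊆ U ∪ V → Closed U V → A ⊆ S → B ⊆ S → Disjoint A B →
    (∀ {x y} → x ∈ A → y ∈ B → Arc T x y) → Pack k U A → Pack k V B → Pack k W S
  Pack-join zero    W⊆ closed A⊆ B⊆ disj A→B _ _ = Unit.tt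
  Pack-join (suc k) W⊆ closed A⊆ B⊆ disj A→B (A₁ , A₁⊆ , M₁ , P₁) (B₁ , B₁⊆ , M₂ , P₂) =
    A₁ ∪ B₁ , ∪-least (⊆-trans A₁⊆ A⊆) (⊆-trans B₁⊆ B⊆)
    , join W⊆ closed (λ x∈ → disj (A₁⊆ x∈) ∘ B₁⊆) (λ x∈ y∈ → A→B (A₁⊆ x∈) (B₁⊆ y∈)) M₁ M₂
    , Pack-join k W⊆ closed
        (λ x∈ → x∈p∧x∉q⇒x∈p─q (A⊆ (p─q⊆p _ A₁ x∈))
          ([ x∈p─q⇒x∉q _ A₁ x∈ , disj (p─q⊆p _ A₁ x∈) ∘ B₁⊆ ]′ ∘ x∈p∪q⁻ A₁ B₁))
        (λ x∈ → x∈p∧x∉q⇒x∈p─q (B⊆ (p─q⊆p _ B₁ x∈))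
          ([ (λ x∈A → disj (A₁⊆ x∈A) (p─q⊆p _ B₁ x∈)) , x∈p─q⇒x∉q _ B₁ x∈ ]′ ∘ x∈p∪q⁻ A₁ B₁))
        (λ x∈ → disj (p─q⊆p _ A₁ x∈) ∘ p─q⊆p _ B₁)
        (λ x∈ y∈ → A→B (p─q⊆p _ A₁ x∈) (p─q⊆p _ B₁ y∈)) P₁ P₂

  -- `F` absorbs the copies taken so far; as each has at most `s` vertices, it remains small enough
  -- for `fresh`.
  Pack-greedy : ∀ {s N} →
    (∀ F → ∣ F ∣ ≤ N → ∃[ A ] (A ⊆ S × Disjoint A F × ∣ A ∣ ≤ s × Model W A)) →
    ∀ k F → ∣ F ∣ + k * s ≤ N → Pack k W (S ─ F)
  Pack-greedy fresh zero    F F≤ = Unit.tt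
  Pack-greedy {S = S} {W = W} {s} {N} fresh (suc k) F F≤ =
    let A , A⊆ , A∩F , A≤ , M = fresh F (≤-trans (m≤m+n ∣ F ∣ _) F≤)
        F′≤ = begin
          ∣ F ∪ A ∣ + k * s   ≤⟨ +-monoˡ-≤ (k * s) (∣p∪q∣≤ F A ≤-refl A≤) ⟩
          ∣ F ∣ + s + k * s   ≡⟨ +-assoc ∣ F ∣ s (k * s) ⟩
          ∣ F ∣ + (s + k * s) ≤⟨ F≤ ⟩
          N                   ∎
    in A , (λ x∈ → x∈p∧x∉q⇒x∈p─q (A⊆ x∈) (A∩F x∈)) , M
     , subst (Pack k W) (sym (p─q─r≡p─q∪r S F A)) (Pack-greedy fresh k (F ∪ A) F′≤)
    where open ≤-Reasoning

-- Labelled models versus topological minor models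

module TopMinors (H T : Digraph) where

  open Models H T

  private variable
    a b : Fin n
    S : Subset n

  -- The first inner vertex is deleted from `P` after the rest of the walk has been replaced by one
  -- that never returns to it, so no vertex repeats.
  simple-path : ∀ m P → ∣ P ∣ ≤ m → a ∉ P → b ∉ P → a ≢ b → Reach (_∈ P) b a →
    ∃[ vs ] (IsPath T a b vs × (∀ {x} → x ∈ˡ vs → x ≡ a ⊎ x ≡ b ⊎ x ∈ P))
  simple-path {a} {b} m P P≤ a∉ b∉ a≢b (last e) =
    a ∷ b ∷ [] , (step e here , (a≢b ∷ []) ∷ [] ∷ [])
    , λ { (here eq) → inj₁ eq ; (there (here eq)) → inj₂ (inj₁ eq) }
  simple-path zero P P≤ a∉ b∉ a≢b (via e c∈ r) =
    contradiction (≤-trans (x∈p⇒∣p-x∣<∣p∣ c∈) P≤) λ ()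
  simple-path {a} {b} (suc m) P P≤ a∉ b∉ a≢b (via {c = c} e c∈ r) =
    let vs , (walk , unique) , vs⊆ = simple-path m (P - c) (s≤s⁻¹ (≤-trans (x∈p⇒∣p-x∣<∣p∣ c∈) P≤))
          (λ c∈′ → x∈p-y⇒x≢y P c c∈′ refl) (b∉ ∘ p─q⊆p P ⁅ c ⁆) (λ { refl → b∉ c∈ }) (restart-here r)
        onto : ∀ {x} → x ∈ˡ vs → x ≡ b ⊎ x ∈ P
        onto x∈ = [ (λ { refl → inj₂ c∈ }) , [ inj₁ , inj₂ ∘ p─q⊆p P ⁅ c ⁆ ]′ ]′ (vs⊆ x∈)
    in a ∷ vs
     , (step e walk , All.tabulate (λ x∈ a≡x → [ a≢b ∘ trans a≡x , a∉ ∘ subst (_∈ P) (sym a≡x) ]′ (onto x∈)) ∷ unique)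
     , λ { (here eq) → inj₁ eq ; (there x∈) → inj₂ (onto x∈) }

  arcH⇒≢ : ∀ {u v} → Arc H u v → u ≢ v
  arcH⇒≢ {u} e refl = contradiction (trans (sym e) (loopless H u)) λ ()

  module ToTopMinor {S} (M : Model ⊤ S) where
    ψ = proj₁ M
    ℓ = proj₁ (proj₂ M)
    open IsModel (proj₂ (proj₂ M))

    ℓψ : ∀ u → ℓ (ψ u) ≡ (u , u)
    ℓψ u = proj₂ (branch u ∈⊤)

    inner? : ∀ u v → Decidable (λ x → x ∈ S × ℓ x ≡ (u , v))
    inner? u v x = x ∈? S ×-dec ℓ x ≟ˡ (u , v)

    unlabelled : ∀ {u v} w → u ≢ v → ψ w ∉ ⟪ inner? u v ⟫
    unlabelled {u} {v} w u≢v ψ∈ with trans (sym (ℓψ w)) (proj₂ (∈⟪⟫⁻ (inner? u v) ψ∈))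
    ... | refl = u≢v refl

    ψ-inj : Injective _≡_ _≡_ ψ
    ψ-inj {u} {v} eq = cong proj₁ (trans (sym (ℓψ u)) (trans (cong ℓ eq) (ℓψ v)))

    opaque
      paths : ∀ u v → Arc H u v →
        ∃[ vs ] (IsPath T (ψ u) (ψ v) vs × (∀ {x} → x ∈ˡ vs → x ≡ ψ u ⊎ x ≡ ψ v ⊎ x ∈ ⟪ inner? u v ⟫))
      paths u v e = simple-path n ⟪ inner? u v ⟫ (∣p∣≤n ⟪ inner? u v ⟫)
        (unlabelled u (arcH⇒≢ e)) (unlabelled v (arcH⇒≢ e)) (arcH⇒≢ e ∘ ψ-inj)
        (Reach-map (∈⟪⟫⁺ (inner? u v)) (conn u v ∈⊤ ∈⊤ e))

    inner-label : ∀ {x} u v e → x ∈ˡ proj₁ (paths u v e) × x ≢ ψ u × x ≢ ψ v → ℓ x ≡ (u , v)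
    inner-label u v e (x∈ , x≢u , x≢v) =
      [ (λ x≡ → contradiction x≡ x≢u)
      , [ (λ x≡ → contradiction x≡ x≢v) , proj₂ ∘ ∈⟪⟫⁻ (inner? u v) ]′ ]′ (proj₂ (proj₂ (paths u v e)) x∈)

    topMinor : TopMinorModel H T
    topMinor = record
      { φ = ψ ; φ-inj = ψ-inj
      ; path = λ u v e → proj₁ (paths u v e)
      ; path-ok = λ u v e → proj₁ (proj₂ (paths u v e))
      -- Internal vertices carry off-diagonal labels, branch vertices diagonal ones.
      ; internal-not-branch = λ { x u v e w x-int refl →
          arcH⇒≢ e (let eq = trans (sym (inner-label u v e x-int)) (ℓψ w)
                    in trans (cong proj₁ eq) (sym (cong proj₂ eq))) }
      ; internally-disjoint = λ x u v e u′ v′ e′ i i′ →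
          let eq = trans (sym (inner-label u v e i)) (inner-label u′ v′ e′ i′)
          in cong proj₁ eq , cong proj₂ eq }

    topMinor⊆ : ∀ {x} → InModel topMinor x → x ∈ S
    topMinor⊆ (inj₁ (w , refl)) = proj₁ (branch w ∈⊤)
    topMinor⊆ (inj₂ (u , v , e , x∈)) with proj₂ (proj₂ (paths u v e)) x∈
    ... | inj₁ refl        = proj₁ (branch u ∈⊤)
    ... | inj₂ (inj₁ refl) = proj₁ (branch v ∈⊤)
    ... | inj₂ (inj₂ x∈P)  = proj₁ (∈⟪⟫⁻ (inner? u v) x∈P)

  disjointModels : ∀ k → Pack k ⊤ S → Σ (Fin k → TopMinorModel H T) λ M →
    PairwiseDisjoint M × (∀ i {x} → InModel (M i) x → x ∈ S)
  disjointModels zero P = (λ ()) , (λ ()) , λ ()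
  disjointModels {S} (suc k) (A , A⊆ , M₀ , P) =
    let Ms , disj , Ms⊆ = disjointModels k P
    in (λ { zero → topMinor ; (suc i) → Ms i })
     , (λ { zero    zero    i≢j → contradiction refl i≢j
          ; zero    (suc j) _ x x∈ x∈′ → x∈p─q⇒x∉q S A (Ms⊆ j x∈′) (topMinor⊆ x∈)
          ; (suc i) zero    _ x x∈ x∈′ → x∈p─q⇒x∉q S A (Ms⊆ i x∈) (topMinor⊆ x∈′)
          ; (suc i) (suc j) i≢j → disj i j (i≢j ∘ cong suc) })
     , λ { zero → A⊆ ∘ topMinor⊆ ; (suc i) → p─q⊆p S A ∘ Ms⊆ i }
    where open ToTopMinor M₀

  -- The walk is cut at its first arrival in `b`, so `Q` is asked only of vertices other than `b`.
  walk⇒reach : ∀ {Q : Fin n → Set} {vs} → Walk T a b (a ∷ vs) → a ≢ b →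
    (∀ {x} → x ∈ˡ vs → x ≢ b → Q x) → Reach Q b a
  walk⇒reach here a≢b inner = contradiction refl a≢b
  walk⇒reach {b = b} (step {b = c} e w) a≢b inner with c Fin.≟ b
  walk⇒reach (step e w)            a≢b inner | yes refl = last e
  walk⇒reach (step e here)         a≢b inner | no c≢b = contradiction refl c≢b
  walk⇒reach (step e w@(step _ _)) a≢b inner | no c≢b =
    via e (inner (here refl) c≢b) (walk⇒reach w c≢b (inner ∘ there))

  path⇒reach : ∀ {Q : Fin n → Set} {vs} → Walk T a b vs → Unique vs → a ≢ b →
    (∀ {x} → x ∈ˡ vs → x ≢ a → x ≢ b → Q x) → Reach Q b a
  path⇒reach here _ a≢b inner = contradiction refl a≢b
  path⇒reach w@(step _ _) (a∉ ∷ _) a≢b inner =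
    walk⇒reach w a≢b λ x∈ → inner (there x∈) (All.lookup a∉ x∈ ∘ sym)

  module FromTopMinor (M : TopMinorModel H T) where
    open DecMembership (Fin._≟_ {n}) using () renaming (_∈?_ to _∈ˡ?_)

    -- Any two proofs of `Arc H u v` are equal, so testing one of them decides the question.
    arc-Σ? : ∀ {u v} {P : Arc H u v → Set} → (∀ e → Dec (P e)) → Dec (Σ (Arc H u v) P)
    arc-Σ? {u} {v} {P} P? with arcH? u v
    ... | no ¬e = no (¬e ∘ proj₁)
    ... | yes e = map′ (e ,_) (λ (e′ , p) → subst P (Decidable⇒UIP.≡-irrelevant Bool._≟_ e′ e) p) (P? e)

    inModel? : Decidable (InModel M)
    inModel? x = Fin.any? (λ w → φ M w Fin.≟ x)
      ⊎-dec Fin.any? λ u → Fin.any? λ v → arc-Σ? λ e → x ∈ˡ? path M u v e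

    Reserved : Fin h → Fin h → Fin n → Set
    Reserved u v x = (u ≡ v × x ≡ φ M u) ⊎ Σ (Arc H u v) λ e → Internal M x u v e

    reserved? : ∀ u v → Decidable (Reserved u v)
    reserved? u v x = (u Fin.≟ v ×-dec x Fin.≟ φ M u) ⊎-dec arc-Σ? λ e →
      x ∈ˡ? path M u v e ×-dec (¬? (x Fin.≟ φ M u) ×-dec ¬? (x Fin.≟ φ M v))

    reserved-disjoint : ∀ {u v u′ v′ x} → Reserved u v x → Reserved u′ v′ x → (u , v) ≡ (u′ , v′)
    reserved-disjoint (inj₁ (refl , eq)) (inj₁ (refl , eq′)) = cong (λ w → w , w) (φ-inj M (trans (sym eq) eq′))
    reserved-disjoint (inj₁ (_ , eq)) (inj₂ (e , i)) = contradiction eq (internal-not-branch M _ _ _ e _ i)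
    reserved-disjoint (inj₂ (e , i)) (inj₁ (_ , eq)) = contradiction eq (internal-not-branch M _ _ _ e _ i)
    reserved-disjoint (inj₂ (e , i)) (inj₂ (e′ , i′)) =
      let u≡ , v≡ = internally-disjoint M _ _ _ e _ _ e′ i i′ in cong₂ _,_ u≡ v≡

    walk : ∀ {u v} → Arc H u v → Reach (Reserved u v) (φ M v) (φ M u)
    walk {u} {v} e = let w , unique = path-ok M u v e in
      path⇒reach w unique (arcH⇒≢ e ∘ φ-inj M) λ x∈ x≢u x≢v → inj₂ (e , x∈ , x≢u , x≢v)

    fromTopMinor : Fin h → (∀ {x} → InModel M x → x ∈ S) → Model ⊤ S
    fromTopMinor u₀ M⊆ = assemble u₀ Reserved reserved? reserved-disjoint reserved⊆
      (φ M) (λ u → inj₁ (refl , refl)) walk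
      where
      reserved⊆ : ∀ {u v x} → Reserved u v x → x ∈ _
      reserved⊆ {u} (inj₁ (_ , x≡))          = M⊆ (inj₁ (u , sym x≡))
      reserved⊆ {u} {v} (inj₂ (e , x∈ , _)) = M⊆ (inj₂ (u , v , e , x∈))

  hitting : ∀ {Z} → Fin h → ¬ Model ⊤ (⊤ ─ Z) → (M : TopMinorModel H T) → ∃[ x ] (x ∈ Z × InModel M x)
  hitting {Z} u₀ ¬M M = decidable-stable (Fin.any? λ x → x ∈? Z ×-dec inModel? x) λ none →
    ¬M (fromTopMinor u₀ λ x∈M → x∈p∧x∉q⇒x∈p─q ∈⊤ λ x∈Z → none (_ , x∈Z , x∈M))
    where open FromTopMinor M

-- Small copies in tournaments

module Tournament (H T : Digraph) (tour : IsTournament T) (u₀ : Fin (size H)) (v₀ : Fin (size T)) where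

  open Models H T

  private variable
    W : Subset h
    S L R F X : Subset n

  ¬arc⇒arc : ∀ {x y} → x ≢ y → ¬ Arc T x y → Arc T y x
  ¬arc⇒arc x≢y ¬xy = [ (λ xy → contradiction xy ¬xy) , id ]′ (proj₁ (tour _ _ x≢y))

  -- Totality of the non-arc relation, diagonal included, as the double counting requires.
  no-2-cycle : ∀ x y → ¬ Arc T x y ⊎ ¬ Arc T y x
  no-2-cycle x y with x Fin.≟ y
  ... | yes refl = inj₁ λ xx → contradiction (trans (sym xx) (loopless T x)) λ ()
  ... | no  x≢y with arc? x y
  ...   | no  ¬xy = inj₁ ¬xy
  ...   | yes xy  = inj₂ λ yx → proj₂ (tour x y x≢y) (xy , yx)

  -- Three vertices per ordered pair: at most two reserved in advance and one connecting vertex.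
  copySize : ℕ
  copySize = h * (h * 3)

  Copy : Subset h → Subset n → Subset n → Set
  Copy W S F = ∃[ A ] (A ⊆ S × Disjoint A F × ∣ A ∣ ≤ copySize × Model W A)

  -- Each path consists of vertices reserved in t u v and one further vertex z,
  -- chosen greedily.
  embed : ∀ {N} (φ : Fin h → Fin n) (t : Fin h → Fin h → Subset n) →
    (∀ u → φ u ∈ t u u) →
    (∀ {u v u′ v′ x} → x ∈ t u v → x ∈ t u′ v′ → (u , v) ≡ (u′ , v′)) →
    (∀ u v → t u v ⊆ S) → (∀ u v → Disjoint (t u v) F) → (∀ u v → ∣ t u v ∣ ≤ 2) →
    (∀ {u v} → u ≢ v → ∀ G → ∣ G ∣ ≤ N → (∀ u v → t u v ⊆ G) →
      ∃[ z ] (z ∈ S × z ∉ G × Reach (_∈ t u v ∪ ⁅ z ⁆) (φ v) (φ u))) →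
    ∣ F ∣ + copySize ≤ N → Copy W S F
  embed {S} {F} {N = N} φ t φ∈ t-disj t⊆S t∩F t≤ connect F≤ =
    A , A⊆S , A∩F , ∣⋃ᶠ∣≤ _ (λ u → ∣⋃ᶠ∣≤ (I u) (I≤ u))
    , assemble u₀ (λ u v x → x ∈ I u v) (λ u v x → x ∈? I u v) I-disj
        (λ {u} {v} → ∈A u v) φ (λ u → p⊆p∪q _ (φ∈ u)) walk
    where
    open ≤-Reasoning
    tails : Subset n
    tails = ⋃ᶠ λ u → ⋃ᶠ (t u)

    t⊆tails : ∀ u v → t u v ⊆ tails
    t⊆tails u v = ∈⋃ᶠ⁺ (λ u → ⋃ᶠ (t u)) u ∘ ∈⋃ᶠ⁺ (t u) v

    Connects : Fin h × Fin h → Subset n → Set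
    Connects (u , v) Z = ∣ Z ∣ ≤ 1 × Z ⊆ S × Disjoint Z tails × (u ≢ v → Reach (_∈ t u v ∪ Z) (φ v) (φ u))

    connection : ∀ p G → ∣ G ∣ ≤ ∣ F ∣ + h * h → ∃[ Z ] (Connects p Z × Disjoint Z G)
    connection (u , v) G G≤ with u Fin.≟ v
    -- Diagonal pairs belong to branch vertices and need no connecting vertex.
    ... | yes u≡v = ⊥ , ( ≤-trans (≤-reflexive (∣⊥∣≡0 n)) z≤n , ⊥⊆ , (λ x∈ → contradiction x∈ ∉⊥)
                        , λ u≢v → contradiction u≡v u≢v)
                  , λ x∈ → contradiction x∈ ∉⊥
    ... | no u≢v =
      let z , z∈ , z∉ , r = connect u≢v (G ∪ tails) G′≤ (λ u v → q⊆p∪q G tails ∘ t⊆tails u v)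
      in ⁅ z ⁆
       , ( ∣⁅x⁆∣≤1 z
         , (λ x∈ → subst (_∈ S) (sym (x∈⁅y⁆⇒x≡y z x∈)) z∈)
         , (λ x∈ → subst (_∉ tails) (sym (x∈⁅y⁆⇒x≡y z x∈)) (z∉ ∘ q⊆p∪q G tails))
         , λ _ → r)
       , λ x∈ → subst (_∉ G) (sym (x∈⁅y⁆⇒x≡y z x∈)) (z∉ ∘ p⊆p∪q tails)
      where
      -- `h * h` accounts for the connecting vertices of other pairs, `h * (h * 2)` for the reserved
      -- ones.
      G′≤ : ∣ G ∪ tails ∣ ≤ N
      G′≤ = begin
        ∣ G ∪ tails ∣                    ≤⟨ ∣p∪q∣≤ G tails G≤ (∣⋃ᶠ∣≤ _ (λ u → ∣⋃ᶠ∣≤ (t u) (t≤ u))) ⟩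
        ∣ F ∣ + h * h + h * (h * 2)      ≡⟨ collect ∣ F ∣ h ⟩
        ∣ F ∣ + h * (h * 3)              ≤⟨ F≤ ⟩
        N                                ∎
        where
        collect : ∀ f h → f + h * h + h * (h * 2) ≡ f + h * (h * 3)
        collect = solve-∀

    choice = greedy (h * h) (λ i → Σ (Subset n) (Connects (remQuot h i))) proj₁ (λ a → Disjoint (proj₁ a))
      (λ _ F⊆G d x∈ → d x∈ ∘ F⊆G) {1} {∣ F ∣ + h * h}
      (λ i G G≤ → let Z , c , Z∩G = connection (remQuot h i) G G≤ in (Z , c) , proj₁ c , Z∩G)
      F (≤-reflexive (cong (∣ F ∣ +_) (*-identityʳ (h * h))))

    Z : Fin h → Fin h → Subset n
    Z u v = proj₁ (proj₁ choice (combine u v))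

    Z-connects : ∀ u v → Connects (u , v) (Z u v)
    Z-connects u v =
      subst (λ p → Connects p (Z u v)) (Fin.remQuot-combine u v) (proj₂ (proj₁ choice (combine u v)))

    Z∩F : ∀ u v → Disjoint (Z u v) F
    Z∩F u v = proj₁ (proj₂ choice) (combine u v)

    Z-disj : ∀ {u v u′ v′ x} → x ∈ Z u v → x ∈ Z u′ v′ → (u , v) ≡ (u′ , v′)
    Z-disj {u} {v} {u′} {v′} x∈ x∈′ with Fin.<-cmp (combine u v) (combine u′ v′)
    ... | tri< lt _ _ = contradiction x∈ (proj₂ (proj₂ choice) lt x∈′)
    ... | tri≈ _ eq _ = let u≡ , v≡ = Fin.combine-injective u v u′ v′ eq in cong₂ _,_ u≡ v≡
    ... | tri> _ _ gt = contradiction x∈′ (proj₂ (proj₂ choice) gt x∈)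

    I : Fin h → Fin h → Subset n
    I u v = t u v ∪ Z u v

    I≤ : ∀ u v → ∣ I u v ∣ ≤ 3
    I≤ u v = ∣p∪q∣≤ (t u v) (Z u v) (t≤ u v) (proj₁ (Z-connects u v))

    A : Subset n
    A = ⋃ᶠ λ u → ⋃ᶠ (I u)

    ∈A : ∀ u v {x} → x ∈ I u v → x ∈ A
    ∈A u v = ∈⋃ᶠ⁺ (λ u → ⋃ᶠ (I u)) u ∘ ∈⋃ᶠ⁺ (I u) v

    ∈A⁻ : ∀ {x} → x ∈ A → ∃[ u ] ∃[ v ] (x ∈ t u v ⊎ x ∈ Z u v)
    ∈A⁻ x∈ = let u , x∈ᵤ = ∈⋃ᶠ⁻ (λ u → ⋃ᶠ (I u)) x∈
                 v , x∈ᵥ = ∈⋃ᶠ⁻ (I u) x∈ᵤ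
             in u , v , x∈p∪q⁻ (t u v) (Z u v) x∈ᵥ

    A⊆S : A ⊆ S
    A⊆S x∈ with ∈A⁻ x∈
    ... | u , v , inj₁ x∈t = t⊆S u v x∈t
    ... | u , v , inj₂ x∈Z = proj₁ (proj₂ (Z-connects u v)) x∈Z

    A∩F : Disjoint A F
    A∩F x∈ with ∈A⁻ x∈
    ... | u , v , inj₁ x∈t = t∩F u v x∈t
    ... | u , v , inj₂ x∈Z = Z∩F u v x∈Z

    Z∩t : ∀ u v u′ v′ → Disjoint (Z u v) (t u′ v′)
    Z∩t u v u′ v′ x∈ = proj₁ (proj₂ (proj₂ (Z-connects u v))) x∈ ∘ t⊆tails u′ v′

    I-disj : ∀ {u v u′ v′ x} → x ∈ I u v → x ∈ I u′ v′ → (u , v) ≡ (u′ , v′)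
    I-disj {u} {v} {u′} {v′} x∈ x∈′ with x∈p∪q⁻ (t u v) (Z u v) x∈ | x∈p∪q⁻ (t u′ v′) (Z u′ v′) x∈′
    ... | inj₁ x∈t | inj₁ x∈t′ = t-disj x∈t x∈t′
    ... | inj₁ x∈t | inj₂ x∈Z′ = contradiction x∈t (Z∩t u′ v′ u v x∈Z′)
    ... | inj₂ x∈Z | inj₁ x∈t′ = contradiction x∈t′ (Z∩t u v u′ v′ x∈Z)
    ... | inj₂ x∈Z | inj₂ x∈Z′ = Z-disj x∈Z x∈Z′

    walk : ∀ {u v} → Arc H u v → Reach (_∈ I u v) (φ v) (φ u)
    walk {u} {v} e = proj₂ (proj₂ (proj₂ (Z-connects u v)))
      λ { refl → contradiction (trans (sym e) (loopless H u)) λ () }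

  -- Out-neighbourhoods and paths of length two

  opaque
    N⁺ : Subset n → Fin n → Subset n
    N⁺ S v = S ∩ ⟪ arc? v ⟫

    ∈N⁺ : ∀ {v x} → x ∈ S → Arc T v x → x ∈ N⁺ S v
    ∈N⁺ {v = v} x∈ vx = x∈p∩q⁺ (x∈ , ∈⟪⟫⁺ (arc? v) vx)

    N⁺⊆ : ∀ {v} → N⁺ S v ⊆ S
    N⁺⊆ {S} = p∩q⊆p S _

    ∈N⁺⇒arc : ∀ {v x} → x ∈ N⁺ S v → Arc T v x
    ∈N⁺⇒arc {S} {v} = ∈⟪⟫⁻ (arc? v) ∘ p∩q⊆q S _

  deg : Subset n → Fin n → ℕ
  deg S v = ∣ N⁺ S v ∣

  -- A vertex `z` of the difference is no out-neighbour of `v`, so the tournament has the arc from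
  -- `z` to `v`; `v ∈ G` ensures that `z` differs from `v`.
  middle : ∀ {N u v G} → N < ∣ N⁺ S u ─ N⁺ S v ∣ → ∣ G ∣ ≤ N → v ∈ G →
    ∃[ z ] (z ∈ S × z ∉ G × Arc T u z × Arc T z v)
  middle {S = S} {u = u} {v} {G} N< G≤ v∈G =
    let z , z∈ , z∉ = ∃∈∉ (N⁺ S u ─ N⁺ S v) G (≤-<-trans G≤ N<)
        z∈N = p─q⊆p (N⁺ S u) (N⁺ S v) z∈
        z∈S = N⁺⊆ z∈N
    in z , z∈S , z∉ , ∈N⁺⇒arc z∈N
     , ¬arc⇒arc (λ v≡z → z∉ (subst (_∈ G) v≡z v∈G)) (x∈p─q⇒x∉q (N⁺ S u) (N⁺ S v) z∈ ∘ ∈N⁺ z∈S)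

  -- Many vertices of nearly equal outdegree

  -- Either difference may be the small one. Avoiding the near twins of earlier choices thus makes
  -- the differences large in both directions.
  NearTwins : ℕ → Subset n → Fin n → Fin n → Set
  NearTwins N S u w = ∣ N⁺ S u ─ N⁺ S w ∣ ≤ N ⊎ ∣ N⁺ S w ─ N⁺ S u ∣ ≤ N

  nearTwins? : ∀ N S u → Decidable (NearTwins N S u)
  nearTwins? N S u w = (∣ N⁺ S u ─ N⁺ S w ∣ ≤? N) ⊎-dec (∣ N⁺ S w ─ N⁺ S u ∣ ≤? N)

  twins : ℕ → Subset n → Subset n → Fin n → Subset n
  twins N S X u = X ∩ ⟪ nearTwins? N S u ⟫

  -- Near twins of u have nearly the same out-neighbours, so both inside and
  -- outside N⁺ u they induce tournaments with too lopsided degrees to be large.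
  ∣twins∣≤ : ∀ {N D u} → X ⊆ S → (∀ {v w} → v ∈ X → w ∈ X → deg S v ≤ deg S w + D) → u ∈ X →
    ∣ twins N S X u ∣ ≤ 2 * (N + D) + 2 * (1 + (N + D))
  ∣twins∣≤ {X} {S} {N} {D} {u} X⊆S close u∈X = begin
    ∣ Y ∣                             ≡⟨ ∣p─q∣+∣p∩q∣≡∣p∣ Y (N⁺ S u) ⟨
    ∣ Y ─ N⁺ S u ∣ + ∣ Y ∩ N⁺ S u ∣   ≡⟨ +-comm ∣ Y ─ N⁺ S u ∣ _ ⟩
    ∣ Y ∩ N⁺ S u ∣ + ∣ Y ─ N⁺ S u ∣   ≤⟨ +-mono-≤ inner outer ⟩
    2 * (N + D) + 2 * (1 + (N + D))   ∎
    where
    open ≤-Reasoning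
    Y = twins N S X u

    Y⊆X : Y ⊆ X
    Y⊆X = p∩q⊆p X _

    -- Since outdegrees differ by at most `D`, a bound on one difference bounds the other.
    two-sided : ∀ {w} → w ∈ Y → ∣ N⁺ S u ─ N⁺ S w ∣ ≤ N + D × ∣ N⁺ S w ─ N⁺ S u ∣ ≤ N + D
    two-sided {w} w∈ with ∈⟪⟫⁻ (nearTwins? N S u) (p∩q⊆q X _ w∈)
    ... | inj₁ ≤N = ≤-trans ≤N (m≤m+n N D)
      , ≤-trans (∣q∣≤∣p∣+d⇒∣q─p∣≤∣p─q∣+d (N⁺ S u) (N⁺ S w) (close (Y⊆X w∈) u∈X)) (+-monoˡ-≤ D ≤N)
    ... | inj₂ ≤N = ≤-trans (∣q∣≤∣p∣+d⇒∣q─p∣≤∣p─q∣+d (N⁺ S w) (N⁺ S u) (close u∈X (Y⊆X w∈))) (+-monoˡ-≤ D ≤N)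
      , ≤-trans ≤N (m≤m+n N D)

    -- Inside `N⁺ S u`, the non-out-neighbours of `x` lie in `N⁺ S u ─ N⁺ S x`.
    inner : ∣ Y ∩ N⁺ S u ∣ ≤ 2 * (N + D)
    inner = total⇒∣p∣≤2*row (λ x y → ¬? (arc? x y)) no-2-cycle (N + D) (Y ∩ N⁺ S u)
      λ {x} x∈ → ≤-trans (p⊆q⇒∣p∣≤∣q∣ (row⊆ x)) (proj₁ (two-sided (p∩q⊆p Y _ x∈)))
      where
      row⊆ : ∀ x → (Y ∩ N⁺ S u) ∩ ⟪ (λ y → ¬? (arc? x y)) ⟫ ⊆ N⁺ S u ─ N⁺ S x
      row⊆ x z∈ = let z∈p , z∈R = x∈p∩q⁻ _ _ z∈ in
        x∈p∧x∉q⇒x∈p─q (p∩q⊆q Y _ z∈p) (∈⟪⟫⁻ (λ y → ¬? (arc? x y)) z∈R ∘ ∈N⁺⇒arc)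

    -- Outside `N⁺ S u`, the out-neighbours of `x` lie in `N⁺ S x ─ N⁺ S u`; the extra 1 is for `x`,
    -- which its row contains.
    outer : ∣ Y ─ N⁺ S u ∣ ≤ 2 * (1 + (N + D))
    outer = total⇒∣p∣≤2*row (λ x y → ¬? (arc? y x)) (λ x y → no-2-cycle y x) (1 + (N + D)) (Y ─ N⁺ S u)
      λ {x} x∈ → ≤-trans (p⊆q⇒∣p∣≤∣q∣ (row⊆ x))
        (∣p∪q∣≤ ⁅ x ⁆ _ (∣⁅x⁆∣≤1 x) (proj₂ (two-sided (p─q⊆p Y _ x∈))))
      where
      row⊆ : ∀ x → (Y ─ N⁺ S u) ∩ ⟪ (λ y → ¬? (arc? y x)) ⟫ ⊆ ⁅ x ⁆ ∪ (N⁺ S x ─ N⁺ S u)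
      row⊆ x {z} z∈ with x∈p∩q⁻ _ _ z∈ | z Fin.≟ x
      ... | _ , _ | yes refl = p⊆p∪q _ (x∈⁅x⁆ x)
      ... | z∈p , z∈R | no z≢x = q⊆p∪q ⁅ x ⁆ _ (x∈p∧x∉q⇒x∈p─q
        (∈N⁺ (X⊆S (Y⊆X (p─q⊆p Y _ z∈p))) (¬arc⇒arc z≢x (∈⟪⟫⁻ (λ y → ¬? (arc? y x)) z∈R)))
        (x∈p─q⇒x∉q Y _ z∈p))

  -- Only the branch vertices are reserved; `middle` supplies a path of length two for every pair.
  spread-embed : ∀ {N} (ψ : Fin h → Fin n) → (∀ u → ψ u ∈ S) → (∀ u → ψ u ∉ F) →
    (∀ {u v} → u ≢ v → N < ∣ N⁺ S (ψ u) ─ N⁺ S (ψ v) ∣) →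
    ∣ F ∣ + copySize ≤ N → Copy W S F
  spread-embed {S} {F} {N = N} ψ ψ∈S ψ∉F spread =
    embed ψ t t⁺ t-disj t⊆S t∩F t≤ connect
    where
    ψ-injective : ∀ {u v} → ψ u ≡ ψ v → u ≡ v
    ψ-injective {u} {v} eq = decidable-stable (u Fin.≟ v) λ u≢v →
      let z , z∈ , _ = ∃∈∉ (N⁺ S (ψ u) ─ N⁺ S (ψ v)) ⊥
                         (≤-<-trans (≤-trans (≤-reflexive (∣⊥∣≡0 n)) z≤n) (spread u≢v))
      in x∈p─q⇒x∉q (N⁺ S (ψ u)) _ z∈ (subst (λ w → z ∈ N⁺ S w) eq (p─q⊆p _ (N⁺ S (ψ v)) z∈))

    t : Fin h → Fin h → Subset n
    t u v = if does (u Fin.≟ v) then ⁅ ψ u ⁆ else ⊥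

    t⁺ : ∀ u → ψ u ∈ t u u
    t⁺ u with u Fin.≟ u
    ... | yes _  = x∈⁅x⁆ (ψ u)
    ... | no u≢u = contradiction refl u≢u

    t⁻ : ∀ u v {x} → x ∈ t u v → u ≡ v × x ≡ ψ u
    t⁻ u v x∈ with u Fin.≟ v
    ... | yes u≡v = u≡v , x∈⁅y⁆⇒x≡y (ψ u) x∈
    ... | no  _   = contradiction x∈ ∉⊥

    t≤ : ∀ u v → ∣ t u v ∣ ≤ 2
    t≤ u v with u Fin.≟ v
    ... | yes _ = ≤-trans (∣⁅x⁆∣≤1 (ψ u)) (s≤s z≤n)
    ... | no  _ = ≤-trans (≤-reflexive (∣⊥∣≡0 n)) z≤n

    t-disj : ∀ {u v u′ v′ x} → x ∈ t u v → x ∈ t u′ v′ → (u , v) ≡ (u′ , v′)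
    t-disj {u} {v} {u′} {v′} x∈ x∈′ with t⁻ u v x∈ | t⁻ u′ v′ x∈′
    ... | refl , x≡ | refl , x≡′ = cong (λ w → w , w) (ψ-injective (trans (sym x≡) x≡′))

    t⊆S : ∀ u v → t u v ⊆ S
    t⊆S u v x∈ = subst (_∈ S) (sym (proj₂ (t⁻ u v x∈))) (ψ∈S u)

    t∩F : ∀ u v → Disjoint (t u v) F
    t∩F u v x∈ = subst (_∉ F) (sym (proj₂ (t⁻ u v x∈))) (ψ∉F u)

    connect : ∀ {u v} → u ≢ v → ∀ G → ∣ G ∣ ≤ N → (∀ u v → t u v ⊆ G) →
      ∃[ z ] (z ∈ S × z ∉ G × Reach (_∈ t u v ∪ ⁅ z ⁆) (ψ v) (ψ u))
    connect {u} {v} u≢v G G≤ t⊆G =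
      let z , z∈ , z∉ , uz , zv = middle (spread u≢v) G≤ (t⊆G v v (t⁺ v))
      in z , z∈ , z∉ , via uz (q⊆p∪q (t u v) _ (x∈⁅x⁆ z)) (last zv)

  -- Branch vertices are picked one by one. Each pick blocks its at most `B` near twins, so `X`
  -- outlasts `h` picks.
  crowd-copy : ∀ {N D B} → X ⊆ S → (∀ {v w} → v ∈ X → w ∈ X → deg S v ≤ deg S w + D) →
    2 * (N + D) + 2 * (1 + (N + D)) ≤ B →
    ∀ F → ∣ F ∣ + copySize ≤ N → ∣ F ∣ + h * B < ∣ X ∣ → Copy W S F
  crowd-copy {X} {S} {W} {N} {D} {B} X⊆S close B≤ F F≤ X<
    with greedy h (λ _ → Σ (Fin n) (_∈ X)) (λ (x , _) → twins N S X x) (λ (x , _) G → x ∉ G)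
      (λ _ F⊆G x∉G → x∉G ∘ F⊆G) {B} {∣ F ∣ + h * B}
      (λ _ G G≤ → let x , x∈ , x∉ = ∃∈∉ X G (≤-<-trans G≤ X<)
                  in (x , x∈) , ≤-trans (∣twins∣≤ X⊆S close x∈) B≤ , x∉)
      F ≤-refl
  ... | a , avoids , later =
    spread-embed (λ u → proj₁ (a u)) (λ u → X⊆S (proj₂ (a u))) avoids spread F≤
    where
    spread : ∀ {u v} → u ≢ v → N < ∣ N⁺ S (proj₁ (a u)) ─ N⁺ S (proj₁ (a v)) ∣
    spread {u} {v} u≢v with Fin.<-cmp u v
    ... | tri< u<v _ _ = ≰⇒> λ ≤N →
      later u<v (x∈p∩q⁺ (proj₂ (a v) , ∈⟪⟫⁺ (nearTwins? N S _) (inj₁ ≤N)))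
    ... | tri≈ _ u≡v _ = contradiction u≡v u≢v
    ... | tri> _ _ v<u = ≰⇒> λ ≤N →
      later v<u (x∈p∩q⁺ (proj₂ (a u) , ∈⟪⟫⁺ (nearTwins? N S _) (inj₂ ≤N)))

  -- Many disjoint arcs from low to high outdegree

  -- Averaging over the `r` positions. The count includes position `i` itself.
  high-indegree : ∀ {r E} → 2 * E < r → (y : Fin r → Fin n) →
    ∃[ i ] (E < ∣ ⊤ ∩ ⟪ (λ j → ¬? (arc? (y i) (y j))) ⟫ ∣)
  high-indegree {r} {E} r> y =
    decidable-stable (Fin.any? λ i → E <? ∣ ⊤ ∩ ⟪ (λ j → ¬? (arc? (y i) (y j))) ⟫ ∣) λ none →
      <⇒≱ (subst (2 * E <_) (sym (∣⊤∣≡n r)) r>)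
        (total⇒∣p∣≤2*row (λ i j → ¬? (arc? (y i) (y j))) (λ i j → no-2-cycle (y i) (y j)) E ⊤
          (λ {i} _ → ≮⇒≥ λ lt → none (i , lt)))

  opaque
    -- A vertex of high indegree takes the place of `v`, its in-neighbours the other places. The
    -- bound is `1 + h` because position `i` itself must be discarded.
    in-star : ∀ {r} → 2 * (1 + h) < r → (y : Fin r → Fin n) → Injective _≡_ _≡_ y → ∀ v →
      Σ (Fin h → Fin r) λ g → Injective _≡_ _≡_ g × (∀ {u} → u ≢ v → Arc T (y (g u)) (y (g v)))
    in-star {r} r> y y-inj v with high-indegree r> y
    ... | i , i> with pick-distinct h (⊤ ∩ ⟪ (λ j → ¬? (arc? (y i) (y j))) ⟫) ⁅ i ⁆
                          (≤-<-trans (+-monoˡ-≤ h (∣⁅x⁆∣≤1 i)) i>)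
    ...   | f , f∈ , f∉ , f-inj = g , g-inj , arcs
      where
      f≢i : ∀ u → f u ≢ i
      f≢i u eq = f∉ u (subst (_∈ ⁅ i ⁆) (sym eq) (x∈⁅x⁆ i))

      g : Fin h → Fin r
      g u = if does (u Fin.≟ v) then i else f u

      g-inj : Injective _≡_ _≡_ g
      g-inj {u} {u′} eq with u Fin.≟ v | u′ Fin.≟ v
      ... | yes refl | yes refl = refl
      ... | yes _    | no  _    = contradiction (sym eq) (f≢i u′)
      ... | no  _    | yes _    = contradiction eq (f≢i u)
      ... | no  _    | no  _    = f-inj eq

      arcs : ∀ {u} → u ≢ v → Arc T (y (g u)) (y (g v))
      arcs {u} u≢v with u Fin.≟ v | v Fin.≟ v
      ... | yes u≡v | _      = contradiction u≡v u≢v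
      ... | no  _   | no v≢v = contradiction refl v≢v
      ... | no  _   | yes _  = ¬arc⇒arc (f≢i u ∘ sym ∘ y-inj)
        (∈⟪⟫⁻ (λ j → ¬? (arc? (y i) (y j))) (p∩q⊆q ⊤ _ (f∈ u)))

  -- The path of `(u , v)` runs `y u u`, `z`, `x u v`, `y u v`, `y v v`: the gap provides the way
  -- down through `z`, a crossing arc leads back up, and an arc of the in-star ends in the branch
  -- vertex of `v`.
  crossing-embed : ∀ {N} → L ⊆ S → R ⊆ S → Disjoint L R →
    (∀ {x y} → x ∈ L → y ∈ R → N < ∣ N⁺ S y ─ N⁺ S x ∣) →
    (x y : Fin h → Fin h → Fin n) → (∀ u v → x u v ∈ L) → (∀ u v → y u v ∈ R) →
    (∀ u v → x u v ∉ F) → (∀ u v → y u v ∉ F) →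
    (∀ {u v u′ v′} → x u v ≡ x u′ v′ → (u , v) ≡ (u′ , v′)) →
    (∀ {u v u′ v′} → y u v ≡ y u′ v′ → (u , v) ≡ (u′ , v′)) →
    (∀ u v → Arc T (x u v) (y u v)) → (∀ {u v} → u ≢ v → Arc T (y u v) (y v v)) →
    ∣ F ∣ + copySize ≤ N → Copy W S F
  crossing-embed {L} {S} {R} {F} {N = N} L⊆S R⊆S L∩R gap x y x∈L y∈R x∉F y∉F x-inj y-inj xy yy =
    embed (λ u → y u u) t (λ u → y∈t u u) t-disj t⊆S t∩F t≤ connect
    where
    t : Fin h → Fin h → Subset n
    t u v = ⁅ x u v ⁆ ∪ ⁅ y u v ⁆

    x∈t : ∀ u v → x u v ∈ t u v
    x∈t u v = p⊆p∪q _ (x∈⁅x⁆ _)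

    y∈t : ∀ u v → y u v ∈ t u v
    y∈t u v = q⊆p∪q ⁅ x u v ⁆ _ (x∈⁅x⁆ _)

    t⁻ : ∀ u v {w} → w ∈ t u v → w ≡ x u v ⊎ w ≡ y u v
    t⁻ u v w∈ with x∈p∪q⁻ ⁅ x u v ⁆ _ w∈
    ... | inj₁ w∈x = inj₁ (x∈⁅y⁆⇒x≡y _ w∈x)
    ... | inj₂ w∈y = inj₂ (x∈⁅y⁆⇒x≡y _ w∈y)

    t≤ : ∀ u v → ∣ t u v ∣ ≤ 2
    t≤ u v = ∣p∪q∣≤ ⁅ x u v ⁆ ⁅ y u v ⁆ (∣⁅x⁆∣≤1 (x u v)) (∣⁅x⁆∣≤1 (y u v))

    x≢y : ∀ {u v u′ v′} → x u v ≢ y u′ v′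
    x≢y eq = L∩R (x∈L _ _) (subst (_∈ R) (sym eq) (y∈R _ _))

    t-disj : ∀ {u v u′ v′ w} → w ∈ t u v → w ∈ t u′ v′ → (u , v) ≡ (u′ , v′)
    t-disj {u} {v} {u′} {v′} w∈ w∈′ with t⁻ u v w∈ | t⁻ u′ v′ w∈′
    ... | inj₁ eq | inj₁ eq′ = x-inj (trans (sym eq) eq′)
    ... | inj₁ eq | inj₂ eq′ = contradiction (trans (sym eq) eq′) x≢y
    ... | inj₂ eq | inj₁ eq′ = contradiction (trans (sym eq′) eq) x≢y
    ... | inj₂ eq | inj₂ eq′ = y-inj (trans (sym eq) eq′)

    t⊆S : ∀ u v → t u v ⊆ S
    t⊆S u v w∈ with t⁻ u v w∈
    ... | inj₁ refl = L⊆S (x∈L _ _)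
    ... | inj₂ refl = R⊆S (y∈R _ _)

    t∩F : ∀ u v → Disjoint (t u v) F
    t∩F u v w∈ with t⁻ u v w∈
    ... | inj₁ refl = x∉F u v
    ... | inj₂ refl = y∉F u v

    connect : ∀ {u v} → u ≢ v → ∀ G → ∣ G ∣ ≤ N → (∀ u v → t u v ⊆ G) →
      ∃[ z ] (z ∈ S × z ∉ G × Reach (_∈ t u v ∪ ⁅ z ⁆) (y v v) (y u u))
    connect {u} {v} u≢v G G≤ t⊆G =
      let z , z∈ , z∉ , uz , zx = middle (gap (x∈L u v) (y∈R u u)) G≤ (t⊆G u v (x∈t u v))
      in z , z∈ , z∉
       , via uz (q⊆p∪q (t u v) _ (x∈⁅x⁆ z))
         (via zx (p⊆p∪q _ (x∈t u v))
          (via (xy u v) (p⊆p∪q _ (y∈t u v)) (last (yy u≢v))))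

  -- Disjoint crossing arcs are picked in `h` blocks of `r`. The upper ends in block `v` contain an
  -- in-star, which provides the branch vertex of `v` and the entries of all paths into it.
  crossing-copy : ∀ {N N₁ r} → 2 * (1 + h) < r → L ⊆ S → R ⊆ S → Disjoint L R →
    (∀ {x y} → x ∈ L → y ∈ R → N < ∣ N⁺ S y ─ N⁺ S x ∣) →
    (∀ G → ∣ G ∣ ≤ N₁ → ∃[ x ] ∃[ y ] (x ∈ L × y ∈ R × Arc T x y × x ∉ G × y ∉ G)) →
    ∀ F → ∣ F ∣ + copySize ≤ N → ∣ F ∣ + h * r * 2 ≤ N₁ → Copy W S F
  crossing-copy {L} {S} {R} {W} {N} {N₁} {r} r> L⊆S R⊆S L∩R gap crossing F F≤ F≤₁
    with greedy (h * r) (λ _ → Σ (Fin n × Fin n) λ (x , y) → x ∈ L × y ∈ R × Arc T x y)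
      (λ ((x , y) , _) → ⁅ x ⁆ ∪ ⁅ y ⁆)
      (λ ((x , y) , _) G → x ∉ G × y ∉ G) (λ _ F⊆G (x∉ , y∉) → x∉ ∘ F⊆G , y∉ ∘ F⊆G) {2} {N₁}
      (λ _ G G≤ → let x , y , x∈ , y∈ , xy , x∉ , y∉ = crossing G G≤
                  in ((x , y) , x∈ , y∈ , xy) , ∣p∪q∣≤ ⁅ x ⁆ ⁅ y ⁆ (∣⁅x⁆∣≤1 x) (∣⁅x⁆∣≤1 y) , x∉ , y∉)
      F F≤₁
  ... | a , avoids , later =
    crossing-embed L⊆S R⊆S L∩R gap (λ u v → x (key u v)) (λ u v → y (key u v))
      (λ u v → proj₁ (proj₂ (a (key u v)))) (λ u v → proj₁ (proj₂ (proj₂ (a (key u v)))))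
      (λ u v → proj₁ (avoids (key u v))) (λ u v → proj₂ (avoids (key u v)))
      (key-inj ∘ x-inj) (key-inj ∘ y-inj)
      (λ u v → proj₂ (proj₂ (proj₂ (a (key u v))))) (λ {_} {v} → proj₂ (proj₂ (star v))) F≤
    where
    x y : Fin (h * r) → Fin n
    x i = proj₁ (proj₁ (a i))
    y i = proj₂ (proj₁ (a i))

    x-inj : Injective _≡_ _≡_ x
    x-inj {i} {j} eq with Fin.<-cmp i j
    ... | tri< i<j _ _ = contradiction (p⊆p∪q _ (subst (_∈ ⁅ x i ⁆) eq (x∈⁅x⁆ _))) (proj₁ (later i<j))
    ... | tri≈ _ i≡j _ = i≡j
    ... | tri> _ _ j<i = contradiction (p⊆p∪q _ (subst (_∈ ⁅ x j ⁆) (sym eq) (x∈⁅x⁆ _))) (proj₁ (later j<i))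

    y-inj : Injective _≡_ _≡_ y
    y-inj {i} {j} eq with Fin.<-cmp i j
    ... | tri< i<j _ _ = contradiction (q⊆p∪q ⁅ x i ⁆ _ (subst (_∈ ⁅ y i ⁆) eq (x∈⁅x⁆ _))) (proj₂ (later i<j))
    ... | tri≈ _ i≡j _ = i≡j
    ... | tri> _ _ j<i = contradiction (q⊆p∪q ⁅ x j ⁆ _ (subst (_∈ ⁅ y j ⁆) (sym eq) (x∈⁅x⁆ _))) (proj₂ (later j<i))

    star : ∀ v → Σ (Fin h → Fin r) λ g → Injective _≡_ _≡_ g ×
      (∀ {u} → u ≢ v → Arc T (y (combine v (g u))) (y (combine v (g v))))
    star v = in-star r> (y ∘ combine v) (λ {i} {j} eq → proj₂ (Fin.combine-injective v i v j (y-inj eq))) v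

    -- The crossing arc through which the path of the arc (u , v) enters v.
    key : Fin h → Fin h → Fin (h * r)
    key u v = combine v (proj₁ (star v) u)

    key-inj : ∀ {u v u′ v′} → key u v ≡ key u′ v′ → (u , v) ≡ (u′ , v′)
    key-inj {u} {v} {u′} {v′} eq = unfold (Fin.combine-injective v (proj₁ (star v) u) v′ (proj₁ (star v′) u′) eq)
      where
      unfold : v ≡ v′ × proj₁ (star v) u ≡ proj₁ (star v′) u′ → (u , v) ≡ (u′ , v′)
      unfold (refl , eq′) = cong (_, v) (proj₁ (proj₂ (star v)) eq′)

  copies⇒Pack : ∀ K → (∀ F → ∣ F ∣ ≤ K * copySize → Copy W S F) → Pack K W S
  copies⇒Pack {W} {S} K fresh = subst (Pack K W) (p─⊥≡p S)
    (Pack-greedy fresh K ⊥ (≤-reflexive (cong (_+ K * copySize) (∣⊥∣≡0 n))))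

  opaque
    -- Without such a cover, every set `G` of this size would miss some crossing arc, and
    -- `crossing-copy` would yield `K` disjoint copies.
    small-cover : ∀ {K N r} → 2 * (1 + h) < r → L ⊆ S → R ⊆ S → Disjoint L R →
      (∀ {x y} → x ∈ L → y ∈ R → N < ∣ N⁺ S y ─ N⁺ S x ∣) →
      K * copySize + copySize ≤ N → ¬ Pack K W S →
      ∃[ Z ] (∣ Z ∣ ≤ K * copySize + h * r * 2 × (∀ x y → x ∈ L → y ∈ R → Arc T x y → x ∈ Z ⊎ y ∈ Z))
    small-cover {L} {S} {R} {W} {K} {N} {r} r> L⊆S R⊆S L∩R gap N≥ ¬P = decidable-stable
      (anySubset? λ Z → (∣ Z ∣ ≤? N₁) ×-dec Fin.all? λ x → Fin.all? λ y →
        x ∈? L →-dec (y ∈? R →-dec (arc? x y →-dec (x ∈? Z ⊎-dec y ∈? Z))))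
      λ none → ¬P (copies⇒Pack K λ F F≤ →
        crossing-copy r> L⊆S R⊆S L∩R gap (uncovered none) F
          (≤-trans (+-monoˡ-≤ copySize F≤) N≥) (+-monoˡ-≤ (h * r * 2) F≤))
      where
      N₁ : ℕ
      -- `K * copySize` for earlier copies, `h * r * 2` for the ends of the crossing arcs of the
      -- current one.
      N₁ = K * copySize + h * r * 2

      uncovered : ¬ (∃[ Z ] (∣ Z ∣ ≤ N₁ × (∀ x y → x ∈ L → y ∈ R → Arc T x y → x ∈ Z ⊎ y ∈ Z))) →
        ∀ G → ∣ G ∣ ≤ N₁ → ∃[ x ] ∃[ y ] (x ∈ L × y ∈ R × Arc T x y × x ∉ G × y ∉ G)
      uncovered none G G≤ = decidable-stable
        (Fin.any? λ x → Fin.any? λ y →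
          x ∈? L ×-dec (y ∈? R ×-dec (arc? x y ×-dec (¬? (x ∈? G) ×-dec ¬? (y ∈? G)))))
        λ no-arc → none (G , G≤ , λ x y x∈ y∈ xy →
          decidable-stable (x ∈? G ⊎-dec y ∈? G) λ ∉G →
            no-arc (x , y , x∈ , y∈ , xy , ∉G ∘ inj₁ , ∉G ∘ inj₂))

  -- Separation by outdegree

  low high : Subset n → ℕ → Subset n
  low  S a = S ∩ ⟪ (λ x → deg S x <? a) ⟫
  high S a = S ∩ ⟪ (λ x → a ≤? deg S x) ⟫

  ∈low⁻ : ∀ a {x} → x ∈ low S a → x ∈ S × deg S x < a
  ∈low⁻ {S} a x∈ = p∩q⊆p S _ x∈ , ∈⟪⟫⁻ (λ x → deg S x <? a) (p∩q⊆q S _ x∈)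

  ∈high⁻ : ∀ a {x} → x ∈ high S a → x ∈ S × a ≤ deg S x
  ∈high⁻ {S} a x∈ = p∩q⊆p S _ x∈ , ∈⟪⟫⁻ (λ x → a ≤? deg S x) (p∩q⊆q S _ x∈)

  ∈low⁺ : ∀ a {x} → x ∈ S → deg S x < a → x ∈ low S a
  ∈low⁺ {S} a x∈ lt = x∈p∩q⁺ (x∈ , ∈⟪⟫⁺ (λ x → deg S x <? a) lt)

  ∈high⁺ : ∀ a {x} → x ∈ S → a ≤ deg S x → x ∈ high S a
  ∈high⁺ {S} a x∈ le = x∈p∩q⁺ (x∈ , ∈⟪⟫⁺ (λ x → a ≤? deg S x) le)

  -- Vertices of outdegree exactly `a` must lie in `Z`, so the two sides are `low S a` and
  -- `high S (suc a)`.
  Cut : Subset n → Subset n → ℕ → Set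
  Cut S Z a = (∀ {x} → x ∈ S → x ∉ Z → deg S x < a ⊎ a < deg S x) ×
    (∀ {x y} → x ∈ S → y ∈ S → x ∉ Z → y ∉ Z → deg S x < a → a < deg S y → ¬ Arc T x y)

  degree-cut : ∀ k a → ¬ Pack (suc k) W S → ∃[ Z ] (∣ Z ∣ ≤ suc k * sepConst h × Cut S Z a)
  degree-cut {W} {S} k a ¬P = M ∪ C , size≤ , covers , no-arc
    where
    K = suc k
    s = copySize
    -- Room for `K` earlier copies and the current one, kept proportional to `K`.
    N = K * (s + s)
    b = 2 * (4 * s) + 2 * (1 + 4 * s)
    -- The least value above `2 * (1 + h)`, as the in-stars require.
    r = 3 + 2 * h
    -- The outdegrees from `a` to `a + N`. Without this band the two sides differ in outdegree by
    -- more than `N`.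
    M = high S a ∩ low S (suc (a + N))

    K*s+s≤N : K * s + s ≤ N
    K*s+s≤N = ≤-trans (+-monoʳ-≤ (K * s) (m≤m+n s (k * s))) (≤-reflexive (sym (*-distribˡ-+ K s s)))

    twins≤ : 2 * (N + N) + 2 * (1 + (N + N)) ≤ K * b
    twins≤ = ≤-trans (+-monoʳ-≤ (2 * (N + N)) (*-monoʳ-≤ 2 (+-monoˡ-≤ (N + N) (s≤s (z≤n {k})))))
                     (≤-reflexive (collect K s))
      where
      collect : ∀ K s → 2 * (K * (s + s) + K * (s + s)) + 2 * (K + (K * (s + s) + K * (s + s)))
                      ≡ K * (2 * (4 * s) + 2 * (1 + 4 * s))
      collect = solve-∀

    M⊆S : M ⊆ S
    M⊆S x∈ = proj₁ (∈high⁻ a (p∩q⊆p _ _ x∈))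

    close : ∀ {v w} → v ∈ M → w ∈ M → deg S v ≤ deg S w + N
    close v∈ w∈ = ≤-trans (s≤s⁻¹ (proj₂ (∈low⁻ (suc (a + N)) (p∩q⊆q (high S a) _ v∈))))
                          (+-monoˡ-≤ N (proj₂ (∈high⁻ a (p∩q⊆p _ _ w∈))))

    M≤ : ∣ M ∣ ≤ K * s + h * (K * b)
    M≤ = ≮⇒≥ λ M> → ¬P (copies⇒Pack K λ F F≤ →
      crowd-copy M⊆S close twins≤ F (≤-trans (+-monoˡ-≤ s F≤) K*s+s≤N)
        (≤-<-trans (+-monoˡ-≤ (h * (K * b)) F≤) M>))

    gap : ∀ {x y} → x ∈ low S a → y ∈ high S (suc (a + N)) → N < ∣ N⁺ S y ─ N⁺ S x ∣
    gap {x} {y} x∈ y∈ = +-cancelˡ-< (deg S x) _ _ (begin-strict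
      deg S x + N                        <⟨ +-monoˡ-< N (proj₂ (∈low⁻ a x∈)) ⟩
      a + N                              <⟨ proj₂ (∈high⁻ (suc (a + N)) y∈) ⟩
      deg S y                            ≤⟨ ∣p∣≤∣q∣+∣p─q∣ (N⁺ S y) (N⁺ S x) ⟩
      deg S x + ∣ N⁺ S y ─ N⁺ S x ∣      ∎)
      where open ≤-Reasoning

    cover = small-cover {L = low S a} {S} {high S (suc (a + N))} {r = r}
      (≤-reflexive (three h))
      (proj₁ ∘ ∈low⁻ a) (proj₁ ∘ ∈high⁻ (suc (a + N)))
      (λ x∈ x∈′ → <⇒≱ (proj₂ (∈low⁻ a x∈))
        (≤-trans (m≤n⇒m≤1+n (m≤m+n a N)) (proj₂ (∈high⁻ (suc (a + N)) x∈′))))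
      gap K*s+s≤N ¬P
      where
      three : ∀ h → 1 + 2 * (1 + h) ≡ 3 + 2 * h
      three = solve-∀

    C = proj₁ cover

    size≤ : ∣ M ∪ C ∣ ≤ K * sepConst h
    size≤ = begin
      ∣ M ∪ C ∣                                          ≤⟨ ∣p∪q∣≤ M C M≤ (proj₁ (proj₂ cover)) ⟩
      K * s + h * (K * b) + (K * s + h * r * 2)          ≤⟨ +-monoʳ-≤ (K * s + h * (K * b)) (+-monoʳ-≤ (K * s) (m≤m+n (h * r * 2) (k * (h * r * 2)))) ⟩
      K * s + h * (K * b) + (K * s + K * (h * r * 2))    ≡⟨ collect K s h b (h * r * 2) ⟩
      K * sepConst h                                     ∎
      where
      open ≤-Reasoning
      collect : ∀ K s h b c → K * s + h * (K * b) + (K * s + K * c) ≡ K * (s + h * b + (s + c))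
      collect = solve-∀

    beyond : ∀ {x} → x ∈ S → x ∉ M ∪ C → a ≤ deg S x → suc (a + N) ≤ deg S x
    beyond x∈ x∉ a≤ = ≮⇒≥ λ lt → x∉ (p⊆p∪q C (x∈p∩q⁺ (∈high⁺ a x∈ a≤ , ∈low⁺ (suc (a + N)) x∈ lt)))

    covers : ∀ {x} → x ∈ S → x ∉ M ∪ C → deg S x < a ⊎ a < deg S x
    covers {x} x∈ x∉ with deg S x <? a
    ... | yes lt = inj₁ lt
    ... | no ≮a  = inj₂ (≤-trans (s≤s (m≤m+n a N)) (beyond x∈ x∉ (≮⇒≥ ≮a)))

    no-arc : ∀ {x y} → x ∈ S → y ∈ S → x ∉ M ∪ C → y ∉ M ∪ C → deg S x < a → a < deg S y → ¬ Arc T x y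
    no-arc {x} {y} x∈ y∈ x∉ y∉ x<a a<y xy =
      [ x∉ ∘ q⊆p∪q M C , y∉ ∘ q⊆p∪q M C ]′
        (proj₂ (proj₂ cover) x y (∈low⁺ a x∈ x<a)
          (∈high⁺ (suc (a + N)) y∈ (beyond y∈ y∉ (<⇒≤ a<y))) xy)

  record Separation (W : Subset h) (S : Subset n) (z k : ℕ) : Set where
    field
      Z left right : Subset n
      Z≤     : ∣ Z ∣ ≤ z
      left⊆  : left ⊆ S
      right⊆ : right ⊆ S
      covers : ∀ {x} → x ∈ S → x ∉ Z → x ∈ left ⊎ x ∈ right
      no-arc : ∀ {x y} → x ∈ left → y ∈ right → ¬ Arc T x y
      ¬Pack-left  : ¬ Pack k W left
      ¬Pack-right : ¬ Pack k W right

  halves : ∀ k → suc k ≤ suc ⌊ k /2⌋ + suc ⌊ k /2⌋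
  halves k = s≤s (≤-trans (n≤1+⌊n/2⌋+⌊n/2⌋ k) (≤-reflexive (sym (+-suc ⌊ k /2⌋ ⌊ k /2⌋))))

  -- Half of a packing fits into `low S (suc a)`, which is disjoint from the right side; another
  -- half on the right would complete `suc k` models.
  cut⇒separation : ∀ {k z Z} a → ¬ Pack (suc k) W S →
    ¬ Pack (suc ⌊ k /2⌋) W (low S a) → Pack (suc ⌊ k /2⌋) W (low S (suc a)) →
    ∣ Z ∣ ≤ z → Cut S Z a → Separation W S z (suc ⌊ k /2⌋)
  cut⇒separation {W} {S} {k} {Z = Z} a ¬P ¬Pa Pa Z≤ (covers , no-arc) = record
    { Z = Z ; left = low S a ─ Z ; right = high S (suc a) ─ Z
    ; Z≤ = Z≤
    ; left⊆ = proj₁ ∘ ∈low⁻ a ∘ p─q⊆p _ Z ; right⊆ = proj₁ ∘ ∈high⁻ (suc a) ∘ p─q⊆p _ Z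
    ; covers = λ x∈ x∉ →
        [ (λ lt → inj₁ (x∈p∧x∉q⇒x∈p─q (∈low⁺ a x∈ lt) x∉))
        , (λ gt → inj₂ (x∈p∧x∉q⇒x∈p─q (∈high⁺ (suc a) x∈ gt) x∉)) ]′ (covers x∈ x∉)
    ; no-arc = λ x∈ y∈ →
        let x∈S , x< = ∈low⁻ a (p─q⊆p _ Z x∈)
            y∈S , y> = ∈high⁻ (suc a) (p─q⊆p _ Z y∈)
        in no-arc x∈S y∈S (x∈p─q⇒x∉q _ Z x∈) (x∈p─q⇒x∉q _ Z y∈) x< y>
    ; ¬Pack-left = ¬Pa ∘ Pack-mono (suc ⌊ k /2⌋) (p─q⊆p _ Z)
    ; ¬Pack-right = λ Q → ¬P (Pack-≤ (halves k) (Pack-+ (suc ⌊ k /2⌋) (suc ⌊ k /2⌋) (proj₁ ∘ ∈low⁻ (suc a))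
        (proj₁ ∘ ∈high⁻ (suc a) ∘ p─q⊆p _ Z)
        (λ x∈ x∈′ → <⇒≱ (proj₂ (∈low⁻ (suc a) x∈)) (proj₂ (∈high⁻ (suc a) (p─q⊆p _ Z x∈′)))) Pa Q)) }

  trivial-separation : ∀ {z k} → ¬ Pack k W S → Separation W S z k
  trivial-separation {W} {S} {k = k} ¬P = record
    { Z = ⊥ ; left = S ; right = ⊥
    ; Z≤ = ≤-trans (≤-reflexive (∣⊥∣≡0 n)) z≤n ; left⊆ = ⊆-refl ; right⊆ = ⊥⊆
    ; covers = λ x∈ _ → inj₁ x∈ ; no-arc = λ _ y∈ → contradiction y∈ ∉⊥
    ; ¬Pack-left = ¬P ; ¬Pack-right = ¬P ∘ Pack-mono k ⊥⊆ }

  separation : ∀ k → ¬ Pack (suc k) W S → Separation W S (suc k * sepConst h) (suc ⌊ k /2⌋)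
  separation {W} {S} k ¬P with pack? (suc ⌊ k /2⌋) W S
  ... | no ¬half = trivial-separation ¬half
  ... | yes half =
    -- `low S 0` is empty, hence disjoint from `S`, so two half packings would add up.
    [ (λ P₀ → contradiction
        (Pack-≤ (halves k) (Pack-+ (suc ⌊ k /2⌋) (suc ⌊ k /2⌋) (proj₁ ∘ ∈low⁻ 0) ⊆-refl
          (λ x∈ _ → contradiction (proj₂ (∈low⁻ 0 x∈)) λ ()) P₀ half)) ¬P)
    , (λ (a , ¬Pa , Pa) → let Z , Z≤ , cut = degree-cut k a ¬P in cut⇒separation a ¬P ¬Pa Pa Z≤ cut)
    ]′ (step-up (λ a → pack? (suc ⌊ k /2⌋) W (low S a)) (suc n)
         -- No outdegree exceeds `n`, so `low S (suc n)` is all of `S`.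
         (Pack-mono (suc ⌊ k /2⌋) (λ x∈ → ∈low⁺ (suc n) x∈ (s≤s (∣p∣≤n (N⁺ S _)))) half))

  -- Layerings

  record Layering (W : Subset h) (S : Subset n) (z : ℕ) : Set where
    field
      Z      : Subset n
      Z≤     : ∣ Z ∣ ≤ z
      rank   : Fin n → ℕ
      height : ℕ
      rank<  : ∀ {x} → x ∈ S → x ∉ Z → rank x < height
      no-arc : ∀ {x y} → x ∈ S → x ∉ Z → y ∈ S → y ∉ Z → rank x < rank y → ¬ Arc T x y
      flat   : ∀ i {A} → (∀ {x} → x ∈ A → x ∈ S × x ∉ Z × rank x ≡ i) → ¬ Model W A

  flat-layering : ¬ Model W S → Layering W S 0
  flat-layering ¬M = record
    { Z = ⊥ ; Z≤ = ≤-reflexive (∣⊥∣≡0 n) ; rank = λ _ → 0 ; height = 1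
    ; rank< = λ _ _ → s≤s z≤n ; no-arc = λ _ _ _ _ ()
    ; flat = λ _ A⊆ M → ¬M (Model-mono (proj₁ ∘ A⊆) M) }

  -- Ranks on the right are shifted by the height of the left layering, so arcs between the sides
  -- point down.
  stack : ∀ {z z₁ z₂ k} (σ : Separation W S z k) →
    Layering W (Separation.left σ) z₁ → Layering W (Separation.right σ) z₂ →
    Layering W S (z + (z₁ + z₂))
  stack {W} {S} σ λ₁ λ₂ = record
    { Z = Z ∪ (L₁.Z ∪ L₂.Z)
    ; Z≤ = ∣p∪q∣≤ Z _ Z≤ (∣p∪q∣≤ L₁.Z L₂.Z L₁.Z≤ L₂.Z≤)
    ; rank = rank ; height = L₁.height + L₂.height
    ; rank< = rank< ; no-arc = no-arc′ ; flat = flat }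
    where
    open Separation σ
    module L₁ = Layering λ₁
    module L₂ = Layering λ₂

    rank : Fin n → ℕ
    rank x = if does (x ∈? left) then L₁.rank x else L₁.height + L₂.rank x

    data Position (x : Fin n) : Set where
      onLeft  : x ∈ left → x ∉ L₁.Z → rank x ≡ L₁.rank x → Position x
      onRight : x ∈ right → x ∉ L₂.Z → rank x ≡ L₁.height + L₂.rank x → Position x

    position : ∀ {x} → x ∈ S → x ∉ Z ∪ (L₁.Z ∪ L₂.Z) → Position x
    position {x} x∈ x∉ = locate (x ∈? left) refl
      where
      locate : (d : Dec (x ∈ left)) → rank x ≡ (if does d then L₁.rank x else L₁.height + L₂.rank x) →
        Position x
      locate (yes x∈l) eq = onLeft x∈l (x∉ ∘ q⊆p∪q Z _ ∘ p⊆p∪q L₂.Z) eq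
      locate (no  x∉l) eq = onRight
        ([ (λ x∈l → contradiction x∈l x∉l) , id ]′ (covers x∈ (x∉ ∘ p⊆p∪q _)))
        (x∉ ∘ q⊆p∪q Z _ ∘ q⊆p∪q L₁.Z L₂.Z) eq

    rank< : ∀ {x} → x ∈ S → x ∉ Z ∪ (L₁.Z ∪ L₂.Z) → rank x < L₁.height + L₂.height
    rank< x∈ x∉ with position x∈ x∉
    ... | onLeft x∈l x∉l eq =
      subst (_< _) (sym eq) (≤-trans (L₁.rank< x∈l x∉l) (m≤m+n L₁.height L₂.height))
    ... | onRight x∈r x∉r eq =
      subst (_< _) (sym eq) (+-monoʳ-< L₁.height (L₂.rank< x∈r x∉r))

    no-arc′ : ∀ {x y} → x ∈ S → x ∉ Z ∪ (L₁.Z ∪ L₂.Z) → y ∈ S → y ∉ Z ∪ (L₁.Z ∪ L₂.Z) →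
      rank x < rank y → ¬ Arc T x y
    no-arc′ x∈ x∉ y∈ y∉ lt with position x∈ x∉ | position y∈ y∉
    ... | onLeft x∈l x∉l eq | onLeft y∈l y∉l eq′ = L₁.no-arc x∈l x∉l y∈l y∉l (subst₂ _<_ eq eq′ lt)
    ... | onLeft x∈l _ _ | onRight y∈r _ _ = no-arc x∈l y∈r
    ... | onRight _ _ eq | onLeft y∈l y∉l eq′ = contradiction (subst₂ _<_ eq eq′ lt)
      (≤⇒≯ (≤-trans (<⇒≤ (L₁.rank< y∈l y∉l)) (m≤m+n L₁.height _)))
    ... | onRight x∈r x∉r eq | onRight y∈r y∉r eq′ =
      L₂.no-arc x∈r x∉r y∈r y∉r (+-cancelˡ-< L₁.height _ _ (subst₂ _<_ eq eq′ lt))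

    flat : ∀ i {A} → (∀ {x} → x ∈ A → x ∈ S × x ∉ Z ∪ (L₁.Z ∪ L₂.Z) × rank x ≡ i) → ¬ Model W A
    flat i {A} A⊆ with i <? L₁.height
    ... | yes i< = L₁.flat i in-left
      where
      in-left : ∀ {x} → x ∈ A → x ∈ left × x ∉ L₁.Z × L₁.rank x ≡ i
      in-left x∈ with A⊆ x∈
      ... | x∈S , x∉Z , rx with position x∈S x∉Z
      ...   | onLeft x∈l x∉l eq = x∈l , x∉l , trans (sym eq) rx
      ...   | onRight _ _ eq = contradiction i<
        (≤⇒≯ (subst (L₁.height ≤_) (trans (sym eq) rx) (m≤m+n L₁.height _)))
    ... | no i≮ = L₂.flat (i ∸ L₁.height) in-right
      where
      in-right : ∀ {x} → x ∈ A → x ∈ right × x ∉ L₂.Z × L₂.rank x ≡ i ∸ L₁.height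
      in-right x∈ with A⊆ x∈
      ... | x∈S , x∉Z , rx with position x∈S x∉Z
      ...   | onLeft x∈l x∉l eq = contradiction (subst (_< L₁.height) (trans (sym eq) rx) (L₁.rank< x∈l x∉l)) i≮
      ...   | onRight x∈r x∉r eq = x∈r , x∉r ,
        trans (sym (m+n∸m≡n L₁.height _)) (cong (_∸ L₁.height) (trans (sym eq) rx))

  weaken : ∀ {z z′} → z ≤ z′ → Layering W S z → Layering W S z′
  weaken z≤ Λ = record { Layering Λ hiding (Z≤) ; Z≤ = ≤-trans (Layering.Z≤ Λ) z≤ }

  -- Each separation halves the packing number, so the recursion ends in parts without a model;
  -- `bound-halve` sums the costs.
  layering : ∀ k → ¬ Pack (suc k) W S → Layering W S (sepConst h * 2 * bound k)
  layering {W} {S} k = <-rec (λ k → ∀ S → ¬ Pack (suc k) W S → Layering W S (c * 2 * bound k)) build k S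
    where
    c = sepConst h

    arith : ∀ k → suc (suc k) * c + (c * 2 * bound ⌊ suc k /2⌋ + c * 2 * bound ⌊ suc k /2⌋) ≤ c * 2 * bound (suc k)
    arith k = begin
      -- `suc (suc k)` is at most twice `suc k`, whence the factor 2.
      suc (suc k) * c + (c * 2 * B + c * 2 * B)   ≤⟨ +-monoˡ-≤ _ (*-monoˡ-≤ c (s≤s (m≤n+m (suc k) k))) ⟩
      (suc k + suc k) * c + (c * 2 * B + c * 2 * B) ≡⟨ collect (suc k) c B ⟩
      c * 2 * (suc k + (B + B))                   ≤⟨ *-monoʳ-≤ (c * 2) (bound-halve (suc k)) ⟩
      c * 2 * bound (suc k)                       ∎
      where
      open ≤-Reasoning
      B = bound ⌊ suc k /2⌋
      collect : ∀ k c B → (k + k) * c + (c * 2 * B + c * 2 * B) ≡ c * 2 * (k + (B + B))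
      collect = solve-∀

    build : ∀ k → (∀ {k′} → k′ < k → ∀ S → ¬ Pack (suc k′) W S → Layering W S (c * 2 * bound k′)) →
      ∀ S → ¬ Pack (suc k) W S → Layering W S (c * 2 * bound k)
    build zero    rec S ¬P = weaken z≤n (flat-layering λ M → ¬P (S , ⊆-refl , M , Unit.tt))
    build (suc k) rec S ¬P = weaken (arith k) (stack σ
      (rec (⌊n/2⌋<n k) _ (Separation.¬Pack-left σ)) (rec (⌊n/2⌋<n k) _ (Separation.¬Pack-right σ)))
      where
      σ = separation (suc k) ¬P

  -- Hitting sets

  closed? : ∀ U V → Dec (Closed U V)
  closed? U V = map′ (λ c {u} {v} → c u v) (λ c u v → c {u} {v})
    (Fin.all? λ u → Fin.all? λ v → u ∈? V →-dec (v ∈? U →-dec ¬? (arcH? u v)))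

  Pack-∅ : ∀ k → Empty W → Pack k W S
  Pack-∅ zero    empty = Unit.tt
  Pack-∅ (suc k) empty = ⊥ , ⊥⊆ , Model-∅ u₀ v₀ empty , Pack-∅ k empty

  ¬Model-empty : Nonempty W → Empty S → ¬ Model W S
  ¬Model-empty W≠∅ empty M = ¬Model-⊥ W≠∅ (Model-mono (λ x∈ → contradiction (_ , x∈) empty) M)

  Hits : ℕ → ℕ → Subset h → Set
  Hits z k W = ∀ S → ¬ Pack k W S → ∃[ Z ] (∣ Z ∣ ≤ z × ¬ Model W (S ─ Z))

  module Layers {W S z} (Λ : Layering W S z) where
    open Layering Λ public

    above below : ℕ → Subset n
    above t = (S ─ Z) ∩ ⟪ (λ x → t ≤? rank x) ⟫
    below t = (S ─ Z) ∩ ⟪ (λ x → rank x <? t) ⟫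

    ∈above⁻ : ∀ t {x} → x ∈ above t → x ∈ S ─ Z × t ≤ rank x
    ∈above⁻ t x∈ = p∩q⊆p (S ─ Z) _ x∈ , ∈⟪⟫⁻ (λ x → t ≤? rank x) (p∩q⊆q (S ─ Z) _ x∈)

    ∈below⁻ : ∀ t {x} → x ∈ below t → x ∈ S ─ Z × rank x < t
    ∈below⁻ t x∈ = p∩q⊆p (S ─ Z) _ x∈ , ∈⟪⟫⁻ (λ x → rank x <? t) (p∩q⊆q (S ─ Z) _ x∈)

    ∈above⁺ : ∀ t {x} → x ∈ S ─ Z → t ≤ rank x → x ∈ above t
    ∈above⁺ t x∈ le = x∈p∩q⁺ (x∈ , ∈⟪⟫⁺ (λ x → t ≤? rank x) le)

    ∈below⁺ : ∀ t {x} → x ∈ S ─ Z → rank x < t → x ∈ below t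
    ∈below⁺ t x∈ lt = x∈p∩q⁺ (x∈ , ∈⟪⟫⁺ (λ x → rank x <? t) lt)

    above-anti : ∀ {t t′} → t ≤ t′ → above t′ ⊆ above t
    above-anti {t} {t′} t≤ x∈ = let x∈S , le = ∈above⁻ t′ x∈ in ∈above⁺ t x∈S (≤-trans t≤ le)

    below-mono : ∀ {t t′} → t ≤ t′ → below t ⊆ below t′
    below-mono {t} {t′} t≤ x∈ = let x∈S , lt = ∈below⁻ t x∈ in ∈below⁺ t′ x∈S (≤-trans lt t≤)

    above-height : Empty (above height)
    above-height (x , x∈) =
      let x∈S , le = ∈above⁻ height x∈
      in <⇒≱ (rank< (p─q⊆p S Z x∈S) (x∈p─q⇒x∉q S Z x∈S)) le

    below↛above : ∀ t {x y} → x ∈ below t → y ∈ above t → ¬ Arc T x y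
    below↛above t x∈ y∈ =
      let x∈S , lt = ∈below⁻ t x∈
          y∈S , le = ∈above⁻ t y∈
      in no-arc (p─q⊆p S Z x∈S) (x∈p─q⇒x∉q S Z x∈S) (p─q⊆p S Z y∈S) (x∈p─q⇒x∉q S Z y∈S) (≤-trans lt le)

    above∩below : ∀ t → Disjoint (above t) (below t)
    above∩below t x∈ x∈′ = <⇒≱ (proj₂ (∈below⁻ t x∈′)) (proj₂ (∈above⁻ t x∈))

    above→below : ∀ t {x y} → x ∈ above t → y ∈ below t → Arc T x y
    above→below t x∈ y∈ = ¬arc⇒arc (λ { refl → above∩below t x∈ y∈ }) (below↛above t y∈ x∈)

    Proper : Subset h → Set
    Proper U = U ⊆ W × Nonempty U × Nonempty (W ─ U) × Closed U (W ─ U)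

    proper? : ∀ U → Dec (Proper U)
    proper? U = U ⊆? W ×-dec (nonempty? U ×-dec (nonempty? (W ─ U) ×-dec closed? U (W ─ U)))

    -- One set `Y` has to serve all cuts `t`, as a leftover model may be split at any of them.
    Blocks : Subset h → Subset n → Set
    Blocks U Y = Proper U → ∀ t → ¬ Model U (above t ─ Y) ⊎ ¬ Model (W ─ U) (below t ─ Y)

    Blocks-mono : ∀ U {Y Y′} → Y ⊆ Y′ → Blocks U Y → Blocks U Y′
    Blocks-mono U Y⊆ blocks proper t =
      [ (λ ¬M → inj₁ (¬M ∘ Model-mono (─-mono ⊆-refl Y⊆)))
      , (λ ¬M → inj₂ (¬M ∘ Model-mono (─-mono ⊆-refl Y⊆))) ]′ (blocks proper t)

    -- Let t be the last position above which there are k disjoint models of U.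
    -- Below t there cannot be k disjoint models of W ─ U, as all arcs go down.
    block : ∀ {z k} → ¬ Pack (suc k) W S → ∀ U → (Proper U → Hits z (suc k) U × Hits z (suc k) (W ─ U)) →
      ∃[ Y ] (∣ Y ∣ ≤ z + z × Blocks U Y)
    block {z} {k} ¬P U hits with proper? U
    ... | no ¬proper = ⊥ , ≤-trans (≤-reflexive (∣⊥∣≡0 n)) z≤n , λ proper → contradiction proper ¬proper
    ... | yes proper@(U⊆W , U≠∅ , _ , closed) =
      [ from-bottom , from-step ]′ (step-up (λ t → ¬? (pack? (suc k) U (above t))) height no-top)
      where
      no-top : ¬ Pack (suc k) U (above height)
      no-top (A , A⊆ , M , _) = ¬Model-empty U≠∅ above-height (Model-mono A⊆ M)

      W⊆ : W ⊆ U ∪ (W ─ U)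
      W⊆ {u} u∈ with u ∈? U
      ... | yes u∈U = p⊆p∪q _ u∈U
      ... | no  u∉U = q⊆p∪q U _ (x∈p∧x∉q⇒x∈p─q u∈ u∉U)

      -- No cut has the packing above it, so hitting `above 0` blocks every cut.
      from-bottom : ¬ Pack (suc k) U (above 0) → ∃[ Y ] (∣ Y ∣ ≤ z + z × Blocks U Y)
      from-bottom ¬P₀ =
        let Y , Y≤ , ¬M = proj₁ (hits proper) (above 0) ¬P₀
        in Y , ≤-trans Y≤ (m≤m+n z z)
         , λ _ t → inj₁ (¬M ∘ Model-mono (─-mono (above-anti (z≤n {t})) ⊆-refl))

      from-step : (∃[ t ] (¬ ¬ Pack (suc k) U (above t) × ¬ Pack (suc k) U (above (suc t)))) →
        ∃[ Y ] (∣ Y ∣ ≤ z + z × Blocks U Y)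
      from-step (t , ¬¬Pt , ¬Pt⁺) =
        let Y₁ , Y₁≤ , ¬M₁ = proj₁ (hits proper) (above (suc t)) ¬Pt⁺
            Y₂ , Y₂≤ , ¬M₂ = proj₂ (hits proper) (below t) λ Q → ¬¬Pt λ P →
              ¬P (Pack-join (suc k) W⊆ closed
                (p─q⊆p S Z ∘ proj₁ ∘ ∈above⁻ t) (p─q⊆p S Z ∘ proj₁ ∘ ∈below⁻ t)
                (above∩below t) (above→below t) P Q)
        in Y₁ ∪ Y₂ , ∣p∪q∣≤ Y₁ Y₂ Y₁≤ Y₂≤
         -- Cuts up to `t` are blocked from below by `Y₂`, higher cuts from above by `Y₁`.
         , λ _ t′ → [ (λ t′≤t → inj₂ (¬M₂ ∘ Model-mono (─-mono (below-mono t′≤t) (q⊆p∪q Y₁ Y₂))))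
                    , (λ t<t′ → inj₁ (¬M₁ ∘ Model-mono (─-mono (above-anti t<t′) (p⊆p∪q Y₂)))) ]′
                    (≤-<-connex t′ t)

    -- Take the last t with a model of W in the layers from t upwards; it is split
    -- properly just above layer t, which contains no model of W itself.
    blocked : ∀ {Y} → Nonempty W → (∀ U → Blocks U Y) → ¬ Model W (S ─ (Z ∪ Y))
    blocked {Y} W≠∅ blocks M₀ =
      [ (λ ¬M → ¬M (Model-mono ⊆above₀ M₀)) , at-step ]′
        (step-up (λ t → ¬? (model? W (above t ─ Y))) height
          (¬Model-empty W≠∅ (λ (x , x∈) → above-height (x , p─q⊆p (above height) Y x∈))))
      where
      ⊆above₀ : S ─ (Z ∪ Y) ⊆ above 0 ─ Y
      ⊆above₀ x∈ = x∈p∧x∉q⇒x∈p─q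
        (∈above⁺ 0 (─-mono ⊆-refl (p⊆p∪q Y) x∈) z≤n) (x∈p─q⇒x∉q S (Z ∪ Y) x∈ ∘ q⊆p∪q Z Y)

      at-step : ¬ (∃[ t ] (¬ ¬ Model W (above t ─ Y) × ¬ Model W (above (suc t) ─ Y)))
      at-step (t , ¬¬M , ¬M⁺) = ¬¬M λ M → finish (split cover no-arc″ M)
        where
        layer : Subset n
        layer = (above t ─ Y) ∩ (below (suc t) ─ Y)

        cover : ∀ {x} → x ∈ above t ─ Y → x ∈ layer ⊎ x ∈ above (suc t) ─ Y
        cover {x} x∈ =
          let x∈S , _ = ∈above⁻ t (p─q⊆p (above t) Y x∈)
              x∉Y = x∈p─q⇒x∉q (above t) Y x∈
          in [ (λ le → inj₁ (x∈p∩q⁺ (x∈ , x∈p∧x∉q⇒x∈p─q (∈below⁺ (suc t) x∈S (s≤s le)) x∉Y)))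
             , (λ gt → inj₂ (x∈p∧x∉q⇒x∈p─q (∈above⁺ (suc t) x∈S gt) x∉Y)) ]′ (≤-<-connex (rank x) t)

        no-arc″ : ∀ {x y} → x ∈ layer → y ∈ above (suc t) ─ Y → ¬ Arc T x y
        no-arc″ x∈ y∈ = below↛above (suc t) (p─q⊆p (below (suc t)) Y (p∩q⊆q (above t ─ Y) _ x∈))
                                            (p─q⊆p (above (suc t)) Y y∈)

        in-layer : ∀ {x} → x ∈ layer → x ∈ S × x ∉ Z × rank x ≡ t
        in-layer x∈ =
          let x∈S , le = ∈above⁻ t (p─q⊆p (above t) Y (p∩q⊆p (above t ─ Y) _ x∈))
              _ , lt = ∈below⁻ (suc t) (p─q⊆p (below (suc t)) Y (p∩q⊆q (above t ─ Y) _ x∈))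
          in p─q⊆p S Z x∈S , x∈p─q⇒x∉q S Z x∈S , ≤-antisym (s≤s⁻¹ lt) le

        finish : ¬ (∃[ U ] (U ⊆ W × Closed U (W ─ U) × Model U (above (suc t) ─ Y) × Model (W ─ U) layer))
        finish (U , U⊆W , closed , M₁ , M₂) with nonempty? U | nonempty? (W ─ U)
        -- With `U` empty, the whole model would lie in layer `t`; with `W ─ U` empty, it would lie
        -- above `t`, against the choice of `t`.
        ... | no U=∅ | _ = flat t in-layer
          (Model-restrict (λ u∈ → x∈p∧x∉q⇒x∈p─q u∈ (λ u∈U → U=∅ (_ , u∈U))) M₂)
        ... | yes _ | no W─U=∅ = ¬M⁺ (Model-restrict
          (λ {u} u∈ → decidable-stable (u ∈? U) λ u∉ → W─U=∅ (u , x∈p∧x∉q⇒x∈p─q u∈ u∉)) M₁)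
        ... | yes U≠∅ | yes W─U≠∅ =
          [ (λ ¬M → ¬M M₁) , (λ ¬M → ¬M (Model-mono (p∩q⊆q (above t ─ Y) _) M₂)) ]′
            (blocks U (U⊆W , U≠∅ , W─U≠∅ , closed) (suc t))

  -- Induction on the bound `j` of `∣ W ∣`: for proper `U`, both `U` and `W ─ U` are smaller, which
  -- supplies the hitting sets for `block`.
  hits : ∀ j W → ∣ W ∣ ≤ j → ∀ k → Hits (hitConst h j * bound (suc k)) (suc k) W
  hits j W W≤ k S ¬P with nonempty? W
  ... | no W=∅ = contradiction (Pack-∅ (suc k) W=∅) ¬P
  hits zero W W≤ k S ¬P | yes (u , u∈) = contradiction (≤-trans (x∈p⇒∣p-x∣<∣p∣ u∈) W≤) λ ()
  hits (suc j) W W≤ k S ¬P | yes W≠∅ =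
    let Y , Y≤ , blocks = uniform-over-subsets h Blocks Blocks-mono (λ U → block ¬P U (smaller U))
    in Z ∪ Y , ≤-trans (∣p∪q∣≤ Z Y Z≤ Y≤)
         (≤-reflexive (collect (sepConst h * 2) (2 ^ h) (hitConst h j) (bound (suc k))))
     , blocked W≠∅ blocks
    where
    Λ : Layering W S (sepConst h * 2 * bound (suc k))
    -- Index `suc k` instead of `k` makes the cost a multiple of `bound (suc k)`, as in the
    -- induction hypothesis.
    Λ = layering (suc k) (¬P ∘ Pack-≤ (n≤1+n (suc k)))
    open Layers Λ

    smaller : ∀ U → Proper U → Hits (hitConst h j * bound (suc k)) (suc k) U
                             × Hits (hitConst h j * bound (suc k)) (suc k) (W ─ U)
    smaller U (U⊆W , (u , u∈) , (w , w∈) , _) =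
      hits j U (s≤s⁻¹ (≤-trans (p⊂q⇒∣p∣<∣q∣ (U⊆W , w , p─q⊆p W U w∈ , x∈p─q⇒x∉q W U w∈)) W≤)) k ,
      hits j (W ─ U) (s≤s⁻¹ (≤-trans
        (p⊂q⇒∣p∣<∣q∣ (p─q⊆p W U , u , U⊆W u∈ , λ u∈─ → x∈p─q⇒x∉q W U u∈─ u∈)) W≤)) k

    collect : ∀ s p c b → s * b + p * (c * b + c * b) ≡ (s + p * (c + c)) * b
    collect = solve-∀

-- From subsets to lists, and the theorem

elements : ∀ {n} → Subset n → List (Fin n)
elements []            = []
elements (outside ∷ p) = map suc (elements p)
elements (inside  ∷ p) = zero ∷ map suc (elements p)

length-elements : ∀ {n} (p : Subset n) → length (elements p) ≡ ∣ p ∣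
length-elements []            = refl
length-elements (outside ∷ p) = trans (length-map suc (elements p)) (length-elements p)
length-elements (inside  ∷ p) = cong suc (trans (length-map suc (elements p)) (length-elements p))

∈-elements : ∀ {n} {p : Subset n} {x} → x ∈ p → x ∈ˡ elements p
∈-elements {p = inside  ∷ p} here       = here refl
∈-elements {p = outside ∷ p} (there x∈) = ∈-map⁺ suc (∈-elements x∈)
∈-elements {p = inside  ∷ p} (there x∈) = there (∈-map⁺ suc (∈-elements x∈))

inhabited? : ∀ n → Dec (Fin n)
inhabited? zero    = no λ ()
inhabited? (suc n) = yes zero

emptyModel : ∀ {H T} → ¬ Fin (size H) → TopMinorModel H T
emptyModel h=0 = record
  { φ = λ u → contradiction u h=0 ; φ-inj = λ {u} → contradiction u h=0
  ; path = λ u → contradiction u h=0 ; path-ok = λ u → contradiction u h=0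
  ; internal-not-branch = λ _ u → contradiction u h=0
  ; internally-disjoint = λ _ u → contradiction u h=0 }

theorem6 : (H : Digraph) → ∃[ c ] ∀ (k : ℕ) → 2 ≤ k → ∀ (T : Digraph) → IsTournament T →
    (Σ (Fin k → TopMinorModel H T) PairwiseDisjoint)
    ⊎ (Σ (List (Fin (size T))) λ S → length S ≤ c * k * ⌊log₂ k ⌋ × HittingSet H T S)
-- `hitConst h h` because `⊤` has `h` elements; the factor 2 absorbs the summand 1 of
-- `1 + ⌊log₂ k ⌋`, as `k` is at least 2.
theorem6 H = hitConst h h * 2 , bounded
  where
  h = size H

  bounded : ∀ k → 2 ≤ k → ∀ T → IsTournament T →
    (Σ (Fin k → TopMinorModel H T) PairwiseDisjoint)
    ⊎ (Σ (List (Fin (size T))) λ S → length S ≤ hitConst h h * 2 * k * ⌊log₂ k ⌋ × HittingSet H T S)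
  bounded k@(suc k′) 2≤k T tour with inhabited? h | inhabited? (size T)
  -- If `H` has no vertices, `k` empty models are vacuously disjoint.
  ... | no h=0 | _ = inj₁ ((λ _ → emptyModel h=0) ,
    λ { _ _ _ _ (inj₁ (w , _)) _ → h=0 w ; _ _ _ _ (inj₂ (u , _)) _ → h=0 u })
  ... | yes u₀ | no T=∅ = inj₂ ([] , z≤n , λ M → contradiction (φ M u₀) T=∅)
  ... | yes u₀ | yes v₀ with pack? k ⊤ ⊤
    where open Models H T
  ...   | yes P = let Ms , disj , _ = disjointModels k P in inj₁ (Ms , disj)
    where open TopMinors H T
  ...   | no ¬P =
    let Z , Z≤ , ¬M = hits h ⊤ (≤-reflexive (∣⊤∣≡n h)) k′ ⊤ ¬P
    in inj₂ (elements Z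
      , (begin
          length (elements Z)                     ≡⟨ length-elements Z ⟩
          ∣ Z ∣                                   ≤⟨ Z≤ ⟩
          c * (k * (1 + lg))                      ≤⟨ *-monoʳ-≤ c (*-monoʳ-≤ k (+-monoˡ-≤ lg (⌊log₂⌋-mono-≤ 2≤k))) ⟩
          c * (k * (lg + lg))                     ≡⟨ collect c k lg ⟩
          c * 2 * k * lg                          ∎)
      , λ M → let x , x∈ , x∈M = hitting u₀ ¬M M in x , ∈-elements x∈ , x∈M)
    where
    open TopMinors H T
    open Tournament H T tour u₀ v₀
    open ≤-Reasoning
    c = hitConst h h
    lg = ⌊log₂ k ⌋
    collect : ∀ c k l → c * (k * (l + l)) ≡ c * 2 * k * l
    collect = solve-∀
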